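{- Let $2\leq k$, $n\geq 2k$, and let $(J(n,k),\mathcal{P})$ be an $S_n$-primitive decomposition. Then $\mathcal{P}$ is one of the following: (1) $\mathcal{P}_\cap$; (2) $\mathcal{P}_\cup$, with $n\neq 2k+2$; (3) $\mathcal{P}_\ominus$, with $(n,k)\neq(4,2)$; (4) $n=2k+2$ and $\mathcal{P}=\{Q_W\cup Q_{X\setminus W}\mid W$ a $(k+1)$-subset of $X\}$ (divisors $\cong 2K_{k+1}$); (5) $(n,k)=(4,2)$ and $\mathcal{P}$ consists of three $4$-cycles: for each partition $\{\pi_1,\pi_2\}$ of $X=\{1,2,3,4\}$ into two $2$-subsets, the part consisting of the edges of $J(4,2)$ between the four $2$-subsets other than $\pi_1,\pi_2$; (6) $(n,k)=(6,3)$ and $\mathcal{P}=\{P_\pi\}$, $\pi$ ranging over partitions of $X$ into three $2$-subsets, where $P_\pi=\{\{A,B\}\mid A,B$ adjacent, $A\ominus B\in\pi$, $A\cap B\in\pi\}$ (divisors $\cong 6K_2$).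
   Context: $X$ is an $n$-set, $J(n,k)$ has vertices the $k$-subsets of $X$, adjacent when they share $k-1$ points, and $S_n=\mathrm{Sym}(X)$ acts naturally. A decomposition is a partition of the edge set into at least two parts (divisors); it is $S_n$-primitive if $S_n$ preserves it and acts primitively (in particular transitively) on its parts. $\mathcal{P}_\cap=\{P_Y\}$, $Y$ ranging over $(k-1)$-subsets, $P_Y$ the complete subgraph on $k$-subsets containing $Y$. $\mathcal{P}_\cup=\{Q_W\}$, $W$ ranging over $(k+1)$-subsets, $Q_W$ the complete subgraph on $k$-subsets of $W$. $\mathcal{P}_\ominus=\{M_{\{a,b\}}\}$, $M_{\{a,b\}}=\{\{\{a\}\cup Y,\{b\}\cup Y\}\mid Y$ a $(k-1)$-subset of $X\setminus\{a,b\}\}$. $\ominus$ is symmetric difference. -}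

module Defs where

open import Data.Nat using (ℕ; suc)
open import Data.Fin using (Fin)
open import Data.Fin.Subset using (Subset; ∣_∣; _∩_; _∪_; _─_; _⊆_; _∈_; _∉_; ∁; ⁅_⁆; ⊤; Empty)
open import Data.Fin.Permutation using (Permutation′; _⟨$⟩ˡ_)
open import Data.Vec using (tabulate; lookup)
open import Data.Product using (Σ; _×_; ∃; ∃-syntax; _,_; proj₁; proj₂)
open import Data.Sum using (_⊎_)
open import Relation.Binary.PropositionalEquality using (_≡_; _≢_)
open import Relation.Nullary using (¬_)
open import Function.Bundles using (_⇔_)

Adj : ∀ {n} → ℕ → Subset n → Subset n → Set
Adj k A B = (∣ A ∣ ≡ k) × (∣ B ∣ ≡ k) × (suc ∣ A ∩ B ∣ ≡ k)

-- Natural action of a permutation σ ∈ Sym(Fin n) on subsets: σ·A = {σ x | x ∈ A}.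
act : ∀ {n} → Permutation′ n → Subset n → Subset n
act σ A = tabulate (λ i → lookup A (σ ⟨$⟩ˡ i))

_⊖_ : ∀ {n} → Subset n → Subset n → Subset n
A ⊖ B = (A ─ B) ∪ (B ─ A)

-- An (unordered) edge {A,B} is given by any ordered pair (A,B) with Adj k A B.
-- A partition of the edge set is encoded by its "same part" relation
-- R A B C D : "the edges {A,B} and {C,D} lie in the same part",
-- only meaningful on pairs of edges.
EdgeRel : ℕ → Set₁
EdgeRel n = Subset n → Subset n → Subset n → Subset n → Set

IsEdgePartition : ∀ {n} → ℕ → EdgeRel n → Set
IsEdgePartition {n} k R =
    (∀ {A B} → Adj k A B → R A B A B)
  × (∀ {A B} → Adj k A B → R A B B A)   -- {A,B} = {B,A}
  × (∀ {A B C D} → Adj k A B → Adj k C D → R A B C D → R C D A B)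
  × (∀ {A B C D E F} → Adj k A B → Adj k C D → Adj k E F →
       R A B C D → R C D E F → R A B E F)

Invariant : ∀ {n} → ℕ → EdgeRel n → Set
Invariant {n} k R = ∀ (σ : Permutation′ n) {A B C D} → Adj k A B → Adj k C D →
  R A B C D → R (act σ A) (act σ B) (act σ C) (act σ D)

Coarser : ∀ {n} → ℕ → EdgeRel n → EdgeRel n → Set
Coarser k R R' = ∀ {A B C D} → Adj k A B → Adj k C D → R A B C D → R' A B C D

SamePartition : ∀ {n} → ℕ → EdgeRel n → EdgeRel n → Set
SamePartition k R R' = ∀ {A B C D} → Adj k A B → Adj k C D → (R A B C D ⇔ R' A B C D)

record PrimitiveDecomposition (n k : ℕ) : Set₁ where
  field
    same        : EdgeRel n
    partition   : IsEdgePartition k same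
    twoParts    : Σ (Subset n) λ A → Σ (Subset n) λ B → Σ (Subset n) λ C → Σ (Subset n) λ D →
                    Adj k A B × Adj k C D × ¬ same A B C D
    invariant   : Invariant k same
    transitive  : ∀ {A B C D} → Adj k A B → Adj k C D →
                    Σ (Permutation′ n) λ σ → same (act σ A) (act σ B) C D
    -- S_n has no nontrivial block system on the parts: every S_n-invariant
    -- partition of the parts (= invariant edge-equivalence coarser than same)
    -- is trivial (all singletons or one block).
    noBlocks    : ∀ (R' : EdgeRel n) → IsEdgePartition k R' → Invariant k R' →
                    Coarser k same R' →
                    SamePartition k R' same
                    ⊎ (∀ {A B C D} → Adj k A B → Adj k C D → R' A B C D)

InP∩ : ∀ {n} → ℕ → Subset n → Subset n → Subset n → Set
InP∩ k Y A B = (suc ∣ Y ∣ ≡ k) × Y ⊆ A × Y ⊆ B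

InQ : ∀ {n} → ℕ → Subset n → Subset n → Subset n → Set
InQ k W A B = (∣ W ∣ ≡ suc k) × A ⊆ W × B ⊆ W

InM : ∀ {n} → ℕ → Fin n → Fin n → Subset n → Subset n → Set
InM k a b A B = Σ _ λ Y → (suc ∣ Y ∣ ≡ k) × a ∉ Y × b ∉ Y ×
  (((A ≡ ⁅ a ⁆ ∪ Y) × (B ≡ ⁅ b ⁆ ∪ Y)) ⊎ ((A ≡ ⁅ b ⁆ ∪ Y) × (B ≡ ⁅ a ⁆ ∪ Y)))

P∩ : ∀ {n} → ℕ → EdgeRel n
P∩ k A B C D = ∃[ Y ] (InP∩ k Y A B × InP∩ k Y C D)

P∪ : ∀ {n} → ℕ → EdgeRel n
P∪ k A B C D = ∃[ W ] (InQ k W A B × InQ k W C D)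

P⊖ : ∀ {n} → ℕ → EdgeRel n
P⊖ k A B C D = ∃[ a ] ∃[ b ] (a ≢ b × InM k a b A B × InM k a b C D)

InQQ : ∀ {n} → ℕ → Subset n → Subset n → Subset n → Set
InQQ k W A B = InQ k W A B ⊎ InQ k (∁ W) A B

PQQ : ∀ {n} → ℕ → EdgeRel n
PQQ k A B C D = ∃[ W ] (InQQ k W A B × InQQ k W C D)

IsPair2 : ∀ {n} → Subset n → Subset n → Set
IsPair2 S T = (∣ S ∣ ≡ 2) × (∣ T ∣ ≡ 2) × Empty (S ∩ T) × (S ∪ T ≡ ⊤)

InC4 : ∀ {n} → Subset n → Subset n → Subset n → Subset n → Set
InC4 S T A B = A ≢ S × A ≢ T × B ≢ S × B ≢ T

PC4 : ∀ {n} → EdgeRel n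
PC4 A B C D = ∃[ S ] ∃[ T ] (IsPair2 S T × InC4 S T A B × InC4 S T C D)

IsTriple2 : ∀ {n} → Subset n → Subset n → Subset n → Set
IsTriple2 P₁ P₂ P₃ = (∣ P₁ ∣ ≡ 2) × (∣ P₂ ∣ ≡ 2) × (∣ P₃ ∣ ≡ 2)
  × Empty (P₁ ∩ P₂) × Empty (P₁ ∩ P₃) × Empty (P₂ ∩ P₃) × (P₁ ∪ P₂ ∪ P₃ ≡ ⊤)

_∈π_ : ∀ {n} → Subset n → (Subset n × Subset n × Subset n) → Set
S ∈π (P₁ , P₂ , P₃) = (S ≡ P₁) ⊎ (S ≡ P₂) ⊎ (S ≡ P₃)

InPπ : ∀ {n} → (Subset n × Subset n × Subset n) → Subset n → Subset n → Set
InPπ π A B = ((A ⊖ B) ∈π π) × ((A ∩ B) ∈π π)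

Pπ : ∀ {n} → EdgeRel n
Pπ A B C D = Σ _ λ π → (IsTriple2 (proj₁ π) (proj₁ (proj₂ π))
  (proj₂ (proj₂ π))) × InPπ π A B × InPπ π C D

{-# OPTIONS --safe #-}

-- Primitivity, applied to the coarsening of the decomposition by an arbitrary proposition, yields
-- excluded middle, so one may argue classically. Let G be the stabiliser of the divisor containing an
-- edge {A , B}, and call two points equivalent if their transposition lies in G. Each of A ∩ B, A ⊖ B and
-- the complement of A ∪ B lies in one class, and G permutes the classes. There is more than one class,
-- since G ≠ Sym(n). If there are two classes, one of the three parts is preserved by G up to
-- complementation; if there are three, either some part has a size of its own and is fixed by G, or all
-- parts have size 2 and (n , k) = (6 , 3). In every case G preserves a family of subsets attached naturally
-- to {A , B}, and by primitivity the divisors are exactly the sets of edges with the same family.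
module Submission where

open import Defs
open import Data.Bool using (Bool; true; false; not; if_then_else_; _∧_; _∨_)
open import Data.Bool.Properties using (⇔→≡; ∧-inverseʳ; not-involutive; ¬-not; not-¬) renaming (_≟_ to _≟ᵇ_)
open import Data.Fin using (Fin; zero; suc; punchIn; punchOut)
open import Data.Fin.Permutation as Perm using (Permutation′; _⟨$⟩ˡ_; _⟨$⟩ʳ_; _∘ₚ_; flip; transpose; insert; inverseˡ; inverseʳ)
import Data.Fin.Permutation.Components as PC
open import Data.Fin.Permutation.Transposition.List using (eval; decompose; eval-decompose)
open import Data.Fin.Properties using (_≟_; punchIn-punchOut)
open import Data.Fin.Subset using (Subset; ∣_∣; _∩_; _∪_; _⊆_; _∈_; _∉_; ∁; ⁅_⁆; ⊤; Empty)
open import Data.Fin.Subset.Properties using (⊆-antisym; ∣∁p∣≡n∸∣p∣; ∣p∣≤n; p⊂q⇒∣p∣<∣q∣; _∈?_; anySubset?; ∈⊤; p∪∁p≡⊤;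
  x∈p∩q⁺; p∩q⊆p; p∩q⊆q; x∈p∪q⁻; p⊆p∪q; q⊆p∪q; x∈⁅x⁆; x≢y⇒x∉⁅y⁆)
open import Data.List using ([]; _∷_)
open import Data.Nat using (ℕ; zero; suc; _≤_; _<_; _*_; _+_)
import Data.Nat.Properties as ℕ
open import Data.Nat.Solver using (module +-*-Solver)
open import Data.Product using (Σ; _×_; _,_; proj₁; proj₂; ∃-syntax)
open import Data.Product.Properties using (≡-dec)
open import Data.Sum using (_⊎_; inj₁; inj₂; [_,_]′)
open import Data.Vec using ([]; _∷_; lookup; zipWith)
import Data.Vec.Properties as Vec
open Vec using (lookup∘tabulate; tabulate∘lookup; tabulate-cong; lookup-zipWith; lookup-map; []=⇒lookup; lookup⇒[]=)
open import Function using (_∘_; _⇔_; mk⇔; Equivalence)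
open import Function.Construct.Composition using (_⇔-∘_)
open import Function.Construct.Symmetry using (⇔-sym)
open import Relation.Binary.Definitions using (DecidableEquality)
open import Relation.Binary.PropositionalEquality
open import Relation.Nullary using (¬_; Dec; yes; no; does; contradiction)
open import Relation.Nullary.Decidable using (dec-true; dec-false; decidable-stable; map′; from-yes; _→-dec_; _×-dec_; _⊎-dec_; ¬?)
open import Algebra.Properties.CommutativeMonoid.Sum ℕ.+-0-commutativeMonoid using (sum; sum-remove; sum-permute; sum-cong-≗)

private
  variable
    n k : ℕ

-- Colourings with equal fibre sizes differ by a permutation.

indicator : Bool → ℕ
indicator b = if b then 1 else 0

module Colouring {K : Set} (_≟ᴷ_ : DecidableEquality K) where

  fibre : (Fin n → K) → K → ℕ
  fibre f c = sum (λ i → indicator (does (f i ≟ᴷ c)))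

  fibre-nonempty : (f : Fin n → K) (c : K) {m : ℕ} → fibre f c ≡ suc m → ∃[ i ] f i ≡ c
  fibre-nonempty {zero} f c ()
  fibre-nonempty {suc n} f c eq with f zero ≟ᴷ c
  ... | yes f₀≡c = zero , f₀≡c
  ... | no _ with i , fᵢ≡c ← fibre-nonempty (f ∘ suc) c eq = suc i , fᵢ≡c

  fibre-remove : (f : Fin (suc n) → K) (i : Fin (suc n)) (c : K) →
    fibre f c ≡ indicator (does (f i ≟ᴷ c)) + fibre (f ∘ punchIn i) c
  fibre-remove f i c = sum-remove {i = i} (λ j → indicator (does (f j ≟ᴷ c)))

  fibre-remove-hit : (f : Fin (suc n) → K) (i : Fin (suc n)) {c : K} → f i ≡ c →
    fibre f c ≡ suc (fibre (f ∘ punchIn i) c)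
  fibre-remove-hit f i {c} fᵢ≡c = trans (fibre-remove f i c)
    (cong (λ b → indicator b + fibre (f ∘ punchIn i) c) (dec-true (f i ≟ᴷ c) fᵢ≡c))

  fibre-empty : (f : Fin n → K) {c : K} → fibre f c ≡ 0 → ∀ i → f i ≢ c
  fibre-empty {suc n} f eq i fᵢ≡c = ℕ.0≢1+n (trans (sym eq) (fibre-remove-hit f i fᵢ≡c))

  fibre-singleton : (f : Fin n → K) {c : K} {i j : Fin n} → fibre f c ≡ 1 → f i ≡ c → f j ≡ c → i ≡ j
  fibre-singleton {suc n} f {c} {i} {j} eq fᵢ fⱼ with i ≟ j
  ... | yes i≡j = i≡j
  ... | no i≢j = contradiction (trans (cong f (punchIn-punchOut i≢j)) fⱼ)
          (fibre-empty (f ∘ punchIn i) (ℕ.suc-injective (trans (sym (fibre-remove-hit f i fᵢ)) eq)) (punchOut i≢j))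

  insert-self : (i j : Fin (suc n)) (π : Permutation′ n) → insert i j π ⟨$⟩ʳ i ≡ j
  insert-self i j π with i ≟ i
  ... | yes _ = refl
  ... | no i≢i = contradiction refl i≢i

  -- Induction on `n`: the colour of `zero` under `f` occurs in `g` at some `j`. A permutation
  -- matching the remaining points extends by sending `zero` to `j`.
  equal-fibres⇒permutation : (f g : Fin n → K) → (∀ c → fibre f c ≡ fibre g c) →
    Σ (Permutation′ n) λ σ → ∀ i → f i ≡ g (σ ⟨$⟩ʳ i)
  equal-fibres⇒permutation {zero} f g eq = Perm.id , λ ()
  equal-fibres⇒permutation {suc n} f g eq
    with j , gⱼ≡f₀ ← fibre-nonempty g (f zero) (trans (sym (eq (f zero))) (fibre-remove-hit f zero refl))
    -- The deleted points `zero` and `j` have the same colour, so both fibre sizes drop by the same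
    -- indicator and stay equal.
    with π , f≗g∘π ← equal-fibres⇒permutation (f ∘ suc) (g ∘ punchIn j) (λ c →
           ℕ.+-cancelˡ-≡ (indicator (does (f zero ≟ᴷ c))) _ _
             (trans (eq c) (trans (fibre-remove g j c)
               (cong (λ x → indicator (does (x ≟ᴷ c)) + fibre (g ∘ punchIn j) c) gⱼ≡f₀))))
    = insert zero j π , λ where
        zero → trans (sym gⱼ≡f₀) (cong g (sym (insert-self zero j π)))
        (suc i) → trans (f≗g∘π i) (cong g (sym (Perm.insert-punchIn zero j π i)))

open Colouring (≡-dec _≟ᵇ_ _≟ᵇ_)

-- The action of permutations on subsets.

subset-ext : {P Q : Subset n} → (∀ i → lookup P i ≡ lookup Q i) → P ≡ Q
subset-ext {P = P} {Q} eq = trans (sym (tabulate∘lookup P)) (trans (tabulate-cong eq) (tabulate∘lookup Q))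

size-sum : (P : Subset n) → ∣ P ∣ ≡ sum (indicator ∘ lookup P)
size-sum [] = refl
size-sum (true ∷ P) = cong suc (size-sum P)
size-sum (false ∷ P) = size-sum P

lookup-act : (σ : Permutation′ n) (P : Subset n) (i : Fin n) → lookup (act σ P) i ≡ lookup P (σ ⟨$⟩ˡ i)
lookup-act σ P i = lookup∘tabulate _ i

lookup-act-ʳ : (σ : Permutation′ n) (P : Subset n) (i : Fin n) → lookup (act σ P) (σ ⟨$⟩ʳ i) ≡ lookup P i
lookup-act-ʳ σ P i = trans (lookup-act σ P _) (cong (lookup P) (inverseˡ σ))

∣act∣ : (σ : Permutation′ n) (P : Subset n) → ∣ act σ P ∣ ≡ ∣ P ∣
∣act∣ σ P = trans (size-sum (act σ P)) (trans
  (sum-cong-≗ (λ i → cong indicator (lookup-act σ P i)))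
  (trans (sym (sum-permute (indicator ∘ lookup P) (flip σ))) (sym (size-sum P))))

act-cong : (σ τ : Permutation′ n) (P : Subset n) → (∀ i → σ ⟨$⟩ˡ i ≡ τ ⟨$⟩ˡ i) → act σ P ≡ act τ P
act-cong σ τ P eq = tabulate-cong (cong (lookup P) ∘ eq)

act-id : (P : Subset n) → act Perm.id P ≡ P
act-id = tabulate∘lookup

act-∘ : (σ τ : Permutation′ n) (P : Subset n) → act σ (act τ P) ≡ act (τ ∘ₚ σ) P
act-∘ σ τ P = tabulate-cong (λ i → lookup-act τ P (σ ⟨$⟩ˡ i))

act-flip-act : (σ : Permutation′ n) (P : Subset n) → act (flip σ) (act σ P) ≡ P
act-flip-act σ P = subset-ext λ i → trans (lookup-act (flip σ) (act σ P) i) (lookup-act-ʳ σ P i)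

act-act-flip : (σ : Permutation′ n) (P : Subset n) → act σ (act (flip σ) P) ≡ P
act-act-flip σ P = act-flip-act (flip σ) P

act-∩ : (σ : Permutation′ n) (P Q : Subset n) → act σ (P ∩ Q) ≡ act σ P ∩ act σ Q
act-∩ σ P Q = subset-ext λ i → trans (lookup-act σ (P ∩ Q) i) (trans (lookup-zipWith _∧_ _ P Q)
  (sym (trans (lookup-zipWith _∧_ i (act σ P) (act σ Q)) (cong₂ _∧_ (lookup-act σ P i) (lookup-act σ Q i)))))

act-∁ : (σ : Permutation′ n) (P : Subset n) → act σ (∁ P) ≡ ∁ (act σ P)
act-∁ σ P = subset-ext λ i → trans (lookup-act σ (∁ P) i) (trans (lookup-map _ not P)
  (sym (trans (lookup-map i not (act σ P)) (cong not (lookup-act σ P i)))))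

Adj-act : (σ : Permutation′ n) (A B : Subset n) → Adj k A B → Adj k (act σ A) (act σ B)
Adj-act σ A B (a , b , ab) = trans (∣act∣ σ A) a , trans (∣act∣ σ B) b ,
  trans (cong suc (trans (cong ∣_∣ (sym (act-∩ σ A B))) (∣act∣ σ (A ∩ B)))) ab

-- Transpositions, their conjugates and the subsets they fix.

transpose-fst : (i j : Fin n) → PC.transpose i j i ≡ j
transpose-fst i j rewrite dec-true (i ≟ i) refl = refl

transpose-snd : (i j : Fin n) → PC.transpose i j j ≡ i
transpose-snd i j with j ≟ i
... | yes j≡i = j≡i
... | no _ rewrite dec-true (j ≟ j) refl = refl

transpose-other : {i j l : Fin n} → l ≢ i → l ≢ j → PC.transpose i j l ≡ l
transpose-other {i = i} {j} {l} l≢i l≢j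
  rewrite dec-false (l ≟ i) l≢i | dec-false (l ≟ j) l≢j = refl

injectiveʳ : (σ : Permutation′ n) {i j : Fin n} → σ ⟨$⟩ʳ i ≡ σ ⟨$⟩ʳ j → i ≡ j
injectiveʳ σ eq = trans (sym (inverseˡ σ)) (trans (cong (σ ⟨$⟩ˡ_) eq) (inverseˡ σ))

transpose-conj : (σ : Permutation′ n) (x y i : Fin n) →
  σ ⟨$⟩ʳ PC.transpose x y i ≡ PC.transpose (σ ⟨$⟩ʳ x) (σ ⟨$⟩ʳ y) (σ ⟨$⟩ʳ i)
transpose-conj σ x y i with i ≟ x
... | yes refl rewrite transpose-fst (σ ⟨$⟩ʳ i) (σ ⟨$⟩ʳ y) = refl
... | no i≢x with i ≟ y
...   | yes refl = sym (transpose-snd (σ ⟨$⟩ʳ x) (σ ⟨$⟩ʳ i))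
...   | no i≢y = sym (transpose-other (i≢x ∘ injectiveʳ σ) (i≢y ∘ injectiveʳ σ))

act-transpose-fixed : {x y : Fin n} (P : Subset n) → lookup P x ≡ lookup P y → act (transpose x y) P ≡ P
act-transpose-fixed {x = x} {y} P eq = subset-ext λ i → trans (lookup-act (transpose x y) P i) (value i)
  where
  value : ∀ i → lookup P (PC.transpose y x i) ≡ lookup P i
  value i with i ≟ y
  ... | yes refl = eq
  ... | no _ with i ≟ x
  ...   | yes refl = sym eq
  ...   | no _ = refl

∣P∣+∣∁P∣≡n : (P : Subset n) → ∣ P ∣ + ∣ ∁ P ∣ ≡ n
∣P∣+∣∁P∣≡n P = trans (cong (∣ P ∣ +_) (∣∁p∣≡n∸∣p∣ P)) (ℕ.m+[n∸m]≡n (∣p∣≤n P))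

-- The three parts of an edge.

-- An edge {A , B} splits the points into A ∩ B, A ⊖ B and the complement of A ∪ B.
data Part : Set where
  meet swap rest : Part

_≟ₚ_ : DecidableEquality Part
meet ≟ₚ meet = yes refl
meet ≟ₚ swap = no λ ()
meet ≟ₚ rest = no λ ()
swap ≟ₚ meet = no λ ()
swap ≟ₚ swap = yes refl
swap ≟ₚ rest = no λ ()
rest ≟ₚ meet = no λ ()
rest ≟ₚ swap = no λ ()
rest ≟ₚ rest = yes refl

kind : Bool → Bool → Part
kind true  true  = meet
kind true  false = swap
kind false true  = swap
kind false false = rest

kind-comm : ∀ a b → kind a b ≡ kind b a
kind-comm true  true  = refl
kind-comm true  false = refl
kind-comm false true  = refl
kind-comm false false = refl

kindAt : Subset n → Subset n → Fin n → Part
kindAt A B i = kind (lookup A i) (lookup B i)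

part : Part → Subset n → Subset n → Subset n
part p A B = zipWith (λ a b → does (kind a b ≟ₚ p)) A B

module _ {n} (A B : Subset n) where

  lookup-part : ∀ p i → lookup (part p A B) i ≡ does (kindAt A B i ≟ₚ p)
  lookup-part p i = lookup-zipWith _ i A B

  part⁺ : ∀ p {i} → kindAt A B i ≡ p → lookup (part p A B) i ≡ true
  part⁺ p {i} eq = trans (lookup-part p i) (dec-true (kindAt A B i ≟ₚ p) eq)

  part⁻ : ∀ p {i} → lookup (part p A B) i ≡ true → kindAt A B i ≡ p
  part⁻ p {i} eq with kindAt A B i ≟ₚ p | lookup-part p i
  ... | yes e | _ = e
  ... | no _  | eq′ = contradiction (trans (sym eq) eq′) λ ()

  part-∉ : ∀ p {i} → kindAt A B i ≢ p → lookup (part p A B) i ≡ false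
  part-∉ p {i} neq = trans (lookup-part p i) (dec-false (kindAt A B i ≟ₚ p) neq)

part-comm : ∀ p (A B : Subset n) → part p A B ≡ part p B A
part-comm p A B = subset-ext λ i → trans (lookup-part A B p i)
  (trans (cong (λ q → does (q ≟ₚ p)) (kind-comm (lookup A i) (lookup B i))) (sym (lookup-part B A p i)))

act-part : (σ : Permutation′ n) → ∀ p (A B : Subset n) → act σ (part p A B) ≡ part p (act σ A) (act σ B)
act-part σ p A B = subset-ext λ i → trans (lookup-act σ (part p A B) i) (trans (lookup-part A B p _)
  (trans (cong₂ (λ a b → does (kind a b ≟ₚ p)) (sym (lookup-act σ A i)) (sym (lookup-act σ B i)))
    (sym (lookup-part (act σ A) (act σ B) p i))))

part-meet : (A B : Subset n) → part meet A B ≡ A ∩ B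
part-meet [] [] = refl
part-meet (true  ∷ A) (true  ∷ B) = cong (true  ∷_) (part-meet A B)
part-meet (true  ∷ A) (false ∷ B) = cong (false ∷_) (part-meet A B)
part-meet (false ∷ A) (true  ∷ B) = cong (false ∷_) (part-meet A B)
part-meet (false ∷ A) (false ∷ B) = cong (false ∷_) (part-meet A B)

part-swap : (A B : Subset n) → part swap A B ≡ A ⊖ B
part-swap [] [] = refl
part-swap (true  ∷ A) (true  ∷ B) = cong (false ∷_) (part-swap A B)
part-swap (true  ∷ A) (false ∷ B) = cong (true  ∷_) (part-swap A B)
part-swap (false ∷ A) (true  ∷ B) = cong (true  ∷_) (part-swap A B)
part-swap (false ∷ A) (false ∷ B) = cong (false ∷_) (part-swap A B)

∁-part-rest : (A B : Subset n) → ∁ (part rest A B) ≡ A ∪ B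
∁-part-rest [] [] = refl
∁-part-rest (true  ∷ A) (true  ∷ B) = cong (true  ∷_) (∁-part-rest A B)
∁-part-rest (true  ∷ A) (false ∷ B) = cong (true  ∷_) (∁-part-rest A B)
∁-part-rest (false ∷ A) (true  ∷ B) = cong (true  ∷_) (∁-part-rest A B)
∁-part-rest (false ∷ A) (false ∷ B) = cong (false ∷_) (∁-part-rest A B)

-- Sizes of the parts, and transitivity on edges.

-- Finer than `kindAt`: it separates `A ─ B` from `B ─ A`, which is needed to carry an ordered pair
-- `(A , B)` to an ordered pair `(C , D)`.
colour : Subset n → Subset n → Fin n → Bool × Bool
colour A B i = lookup A i , lookup B i

module _ where
  private
    #_ : Bool × Bool → Subset n → Subset n → ℕ
    (# c) A B = fibre (colour A B) c

    tt tf ft ff : Bool × Bool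
    tt = true , true
    tf = true , false
    ft = false , true
    ff = false , false

  size-part-meet : (A B : Subset n) → ∣ part meet A B ∣ ≡ (# tt) A B
  size-part-meet [] [] = refl
  size-part-meet (true  ∷ A) (true  ∷ B) = cong suc (size-part-meet A B)
  size-part-meet (true  ∷ A) (false ∷ B) = size-part-meet A B
  size-part-meet (false ∷ A) (true  ∷ B) = size-part-meet A B
  size-part-meet (false ∷ A) (false ∷ B) = size-part-meet A B

  size-part-swap : (A B : Subset n) → ∣ part swap A B ∣ ≡ (# tf) A B + (# ft) A B
  size-part-swap [] [] = refl
  size-part-swap (true  ∷ A) (true  ∷ B) = size-part-swap A B
  size-part-swap (true  ∷ A) (false ∷ B) = cong suc (size-part-swap A B)
  size-part-swap (false ∷ A) (true  ∷ B) = trans (cong suc (size-part-swap A B)) (sym (ℕ.+-suc _ _))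
  size-part-swap (false ∷ A) (false ∷ B) = size-part-swap A B

  size-part-rest : (A B : Subset n) → ∣ part rest A B ∣ ≡ (# ff) A B
  size-part-rest [] [] = refl
  size-part-rest (true  ∷ A) (true  ∷ B) = size-part-rest A B
  size-part-rest (true  ∷ A) (false ∷ B) = size-part-rest A B
  size-part-rest (false ∷ A) (true  ∷ B) = size-part-rest A B
  size-part-rest (false ∷ A) (false ∷ B) = cong suc (size-part-rest A B)

  size-fst : (A B : Subset n) → ∣ A ∣ ≡ (# tf) A B + (# tt) A B
  size-fst [] [] = refl
  size-fst (true  ∷ A) (true  ∷ B) = trans (cong suc (size-fst A B)) (sym (ℕ.+-suc _ _))
  size-fst (true  ∷ A) (false ∷ B) = cong suc (size-fst A B)
  size-fst (false ∷ A) (true  ∷ B) = size-fst A B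
  size-fst (false ∷ A) (false ∷ B) = size-fst A B

  size-snd : (A B : Subset n) → ∣ B ∣ ≡ (# ft) A B + (# tt) A B
  size-snd [] [] = refl
  size-snd (true  ∷ A) (true  ∷ B) = trans (cong suc (size-snd A B)) (sym (ℕ.+-suc _ _))
  size-snd (true  ∷ A) (false ∷ B) = size-snd A B
  size-snd (false ∷ A) (true  ∷ B) = cong suc (size-snd A B)
  size-snd (false ∷ A) (false ∷ B) = size-snd A B

  size-total : (A B : Subset n) → (# ff) A B + ((# tf) A B + ((# ft) A B + (# tt) A B)) ≡ n
  size-total [] [] = refl
  size-total (true  ∷ A) (true  ∷ B) = trans (cong (_+_ ((# ff) A B)) (trans (cong (_+_ ((# tf) A B)) (ℕ.+-suc _ _)) (ℕ.+-suc _ _)))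
    (trans (ℕ.+-suc _ _) (cong suc (size-total A B)))
  size-total (true  ∷ A) (false ∷ B) = trans (ℕ.+-suc _ _) (cong suc (size-total A B))
  size-total (false ∷ A) (true  ∷ B) = trans (cong (_+_ ((# ff) A B)) (ℕ.+-suc _ _)) (trans (ℕ.+-suc _ _) (cong suc (size-total A B)))
  size-total (false ∷ A) (false ∷ B) = cong suc (size-total A B)

  module _ (A B : Subset n) (adj : Adj k A B) where
    private
      tt-size : suc ((# tt) A B) ≡ k
      tt-size = trans (cong suc (trans (sym (size-part-meet A B)) (cong ∣_∣ (part-meet A B)))) (proj₂ (proj₂ adj))

    -- `A` has `k` points and `A ∩ B` has one fewer, so `A ─ B` is a single point.
    fibre-tf : (# tf) A B ≡ 1
    fibre-tf = ℕ.+-cancelʳ-≡ _ _ _ (trans (sym (size-fst A B)) (trans (proj₁ adj) (sym tt-size)))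

    fibre-ft : (# ft) A B ≡ 1
    fibre-ft = ℕ.+-cancelʳ-≡ _ _ _ (trans (sym (size-snd A B)) (trans (proj₁ (proj₂ adj)) (sym tt-size)))

    suc-size-meet : suc ∣ part meet A B ∣ ≡ k
    suc-size-meet = trans (cong suc (size-part-meet A B)) tt-size

    size-swap : ∣ part swap A B ∣ ≡ 2
    size-swap = trans (size-part-swap A B) (cong₂ _+_ fibre-tf fibre-ft)

    size-rest : ∣ part rest A B ∣ + suc k ≡ n
    size-rest = trans (cong₂ _+_ (size-part-rest A B) eq) (size-total A B)
      where
      eq : suc k ≡ (# tf) A B + ((# ft) A B + (# tt) A B)
      eq = trans (cong suc (sym tt-size)) (sym (cong₂ (λ x y → x + (y + (# tt) A B)) fibre-tf fibre-ft))

  module _ (A B C D : Subset n) (ab : Adj k A B) (cd : Adj k C D) where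

    edge-fibres : ∀ c → fibre (colour A B) c ≡ fibre (colour C D) c
    edge-fibres (true  , true)  = ℕ.suc-injective (trans (trans (cong suc (sym (size-part-meet A B))) (suc-size-meet A B ab))
      (sym (trans (cong suc (sym (size-part-meet C D))) (suc-size-meet C D cd))))
    edge-fibres (true  , false) = trans (fibre-tf A B ab) (sym (fibre-tf C D cd))
    edge-fibres (false , true)  = trans (fibre-ft A B ab) (sym (fibre-ft C D cd))
    edge-fibres (false , false) = ℕ.+-cancelʳ-≡ (suc k) _ _ (trans (trans (cong (_+ suc k) (sym (size-part-rest A B))) (size-rest A B ab))
      (sym (trans (cong (_+ suc k) (sym (size-part-rest C D))) (size-rest C D cd))))

    -- Adjacency fixes the sizes of all four colour classes, so some permutation matches the colours
    -- of the two edges, ends in order.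
    edge-transitive : Σ (Permutation′ n) λ σ → act σ A ≡ C × act σ B ≡ D
    edge-transitive with σ , eq ← equal-fibres⇒permutation (colour A B) (colour C D) edge-fibres =
      σ , subset-ext (λ i → trans (lookup-act σ A i) (cong proj₁ (at σ eq i)))
        , subset-ext (λ i → trans (lookup-act σ B i) (cong proj₂ (at σ eq i)))
      where
      at : ∀ σ → (∀ i → colour A B i ≡ colour C D (σ ⟨$⟩ʳ i)) → ∀ i → colour A B (σ ⟨$⟩ˡ i) ≡ colour C D i
      at σ eq i = trans (eq (σ ⟨$⟩ˡ i)) (cong (colour C D) (inverseʳ σ))

-- Natural families of subsets and the edge partitions they induce.

-- Symmetry makes the family depend on the unordered edge, and naturality makes having the same
-- family a `Sym(n)`-invariant relation. Such relations are the coarsenings to which primitivity is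
-- applied.
record NaturalFamily (n : ℕ) : Set₁ where
  field
    family : Subset n → Subset n → Subset n → Set
    symmetric : ∀ {A B} P → family A B P → family B A P
    natural : ∀ σ {A B} P → family A B P → family (act σ A) (act σ B) (act σ P)

  natural⁻ : ∀ σ {A B} P → family (act σ A) (act σ B) P → family A B (act (flip σ) P)
  natural⁻ σ {A} {B} P p = subst₂ (λ X Y → family X Y (act (flip σ) P))
    (act-flip-act σ A) (act-flip-act σ B) (natural (flip σ) P p)

  sameFamily : EdgeRel n
  sameFamily A B C D = ∀ P → family A B P ⇔ family C D P

  sameFamily-partition : IsEdgePartition k sameFamily
  sameFamily-partition = (λ _ _ → mk⇔ (λ p → p) (λ p → p)) , (λ _ P → mk⇔ (symmetric P) (symmetric P))
    , (λ _ _ eq P → mk⇔ (from (eq P)) (to (eq P)))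
    , (λ _ _ _ eq eq′ P → mk⇔ (to (eq′ P) ∘ to (eq P)) (from (eq P) ∘ from (eq′ P)))
    where open Equivalence

  -- Pull `P` back along `σ`, use the inclusion of families there, and push the result forward
  -- again.
  sameFamily-act : ∀ σ {A B C D} → (∀ P → family A B P → family C D P) →
    ∀ P → family (act σ A) (act σ B) P → family (act σ C) (act σ D) P
  sameFamily-act σ sub P p = subst (family _ _) (act-act-flip σ P) (natural σ _ (sub _ (natural⁻ σ P p)))

  sameFamily-invariant : Invariant k sameFamily
  sameFamily-invariant σ _ _ eq P = mk⇔ (sameFamily-act σ (λ Q → Equivalence.to (eq Q)) P)
    (sameFamily-act σ (λ Q → Equivalence.from (eq Q)) P)

subset-ext-true : {P Q : Subset n} → (∀ i → lookup P i ≡ true ⇔ lookup Q i ≡ true) → P ≡ Q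
subset-ext-true {P = P} {Q} eq = subset-ext λ i → ⇔→≡ (eq i)

UpToComplement : Subset n → Subset n → Set
UpToComplement P Q = Q ≡ P ⊎ Q ≡ ∁ P

-- The stabiliser of a divisor.

module PrimitiveGroup {n k : ℕ} (𝒫 : PrimitiveDecomposition n k) where
  open PrimitiveDecomposition 𝒫

  same-refl : ∀ A B → Adj k A B → same A B A B
  same-refl A B = proj₁ partition

  same-flip : ∀ A B → Adj k A B → same A B B A
  same-flip A B = proj₁ (proj₂ partition)

  same-sym : ∀ A B C D → Adj k A B → Adj k C D → same A B C D → same C D A B
  same-sym A B C D = proj₁ (proj₂ (proj₂ partition))

  same-trans : ∀ A B C D E F → Adj k A B → Adj k C D → Adj k E F →
    same A B C D → same C D E F → same A B E F
  same-trans A B C D E F = proj₂ (proj₂ (proj₂ partition))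

  -- Coarsening by a proposition P gives an invariant partition, equal to the given one if ¬ P
  -- and trivial if P, so that primitivity decides P.
  excluded-middle : (P : Set) → Dec P
  excluded-middle P with noBlocks (λ A B C D → same A B C D ⊎ P)
    ( (λ e → inj₁ (proj₁ partition e))
    , (λ e → inj₁ (proj₁ (proj₂ partition) e))
    , (λ e f → [ inj₁ ∘ proj₁ (proj₂ (proj₂ partition)) e f , inj₂ ]′)
    , (λ { e f g (inj₁ x) (inj₁ y) → inj₁ (proj₂ (proj₂ (proj₂ partition)) e f g x y)
         ; e f g (inj₁ _) (inj₂ p) → inj₂ p
         ; e f g (inj₂ p) _ → inj₂ p }))
    (λ σ e f → [ inj₁ ∘ invariant σ e f , inj₂ ]′)
    (λ _ _ → inj₁)
    | twoParts
  ... | inj₁ fine | _ , _ , _ , _ , e , f , ¬same = no λ p → ¬same (Equivalence.to (fine e f) (inj₂ p))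
  ... | inj₂ coarse | _ , _ , _ , _ , e , f , ¬same with coarse e f
  ...   | inj₁ s = contradiction s ¬same
  ...   | inj₂ p = yes p

  A₀ B₀ : Subset n
  A₀ = proj₁ twoParts
  B₀ = proj₁ (proj₂ twoParts)

  e₀ : Adj k A₀ B₀
  e₀ = proj₁ (proj₂ (proj₂ (proj₂ (proj₂ twoParts))))

  e₀· : ∀ σ → Adj k (act σ A₀) (act σ B₀)
  e₀· σ = Adj-act σ A₀ B₀ e₀

  -- The stabiliser in Sym(n) of the divisor containing {A₀ , B₀}.
  G : Permutation′ n → Set
  G σ = same A₀ B₀ (act σ A₀) (act σ B₀)

  G-resp : ∀ σ τ → (∀ i → σ ⟨$⟩ˡ i ≡ τ ⟨$⟩ˡ i) → G σ → G τ
  G-resp σ τ eq = subst₂ (same A₀ B₀) (act-cong σ τ A₀ eq) (act-cong σ τ B₀ eq)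

  G-fixing : ∀ σ → act σ A₀ ≡ A₀ → act σ B₀ ≡ B₀ → G σ
  G-fixing σ a b = subst₂ (same A₀ B₀) (sym a) (sym b) (same-refl A₀ B₀ e₀)

  G-id : G Perm.id
  G-id = G-fixing Perm.id (act-id A₀) (act-id B₀)

  -- Invariance under `σ` translates the relation expressed by `G τ`, and transitivity joins it to
  -- `G σ`. In `τ ∘ₚ σ` the permutation `τ` acts first.
  G-∘ : ∀ σ τ → G σ → G τ → G (τ ∘ₚ σ)
  G-∘ σ τ gσ gτ = subst₂ (same A₀ B₀) (act-∘ σ τ A₀) (act-∘ σ τ B₀)
    (same-trans A₀ B₀ (act σ A₀) (act σ B₀) (act σ (act τ A₀)) (act σ (act τ B₀)) e₀ (e₀· σ) (Adj-act σ (act τ A₀) (act τ B₀) (e₀· τ))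
      gσ (invariant σ e₀ (e₀· τ) gτ))

  G-flip : ∀ σ → G σ → G (flip σ)
  G-flip σ g = same-sym (act (flip σ) A₀) (act (flip σ) B₀) A₀ B₀ (e₀· (flip σ)) e₀
    (subst₂ (same _ _) (act-flip-act σ A₀) (act-flip-act σ B₀) (invariant (flip σ) e₀ (e₀· σ) g))

  orbit : ∀ A B → Adj k A B → Σ (Permutation′ n) λ σ → act σ A₀ ≡ A × act σ B₀ ≡ B
  orbit A B = edge-transitive A₀ B₀ A B e₀

  -- Every edge is a translate of the base edge, so a stabiliser equal to `Sym(n)` would leave only
  -- one divisor.
  G-proper : ¬ (∀ σ → G σ)
  G-proper all =
    let C , D , _ , f , ¬same = proj₂ (proj₂ twoParts)
        σ , a , b = orbit C D f
    in ¬same (subst₂ (same A₀ B₀) a b (all σ))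

  -- Applying the inverse of `σ` to both edges brings the first one back to the base edge.
  same⇒G : ∀ σ τ → same (act σ A₀) (act σ B₀) (act τ A₀) (act τ B₀) → G (τ ∘ₚ flip σ)
  same⇒G σ τ s = subst₂ (same A₀ B₀) (act-∘ (flip σ) τ A₀) (act-∘ (flip σ) τ B₀)
    (subst₂ (λ X Y → same X Y (act (flip σ) (act τ A₀)) (act (flip σ) (act τ B₀))) (act-flip-act σ A₀) (act-flip-act σ B₀)
      (invariant (flip σ) (e₀· σ) (e₀· τ) s))

  module _ (𝓕 : NaturalFamily n) where
    open NaturalFamily 𝓕

    module _ (preserved : ∀ σ → G σ → ∀ P → family A₀ B₀ P → family A₀ B₀ (act σ P)) where

      -- Pull `P` back to the base edge along `σ`, move it there by `ρ`, and push it forward along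
      -- `τ`. Here `ρ` first applies `σ` and then the inverse of `τ`; it lies in `G`, and the net
      -- effect on `P` is trivial.
      family-along : ∀ σ τ → same (act σ A₀) (act σ B₀) (act τ A₀) (act τ B₀) →
        ∀ P → family (act σ A₀) (act σ B₀) P → family (act τ A₀) (act τ B₀) P
      family-along σ τ s P p = subst (family _ _) back
        (natural τ _ (preserved ρ (G-flip (τ ∘ₚ flip σ) (same⇒G σ τ s)) (act (flip σ) P) (natural⁻ σ P p)))
        where
        ρ = flip (τ ∘ₚ flip σ)
        back : act τ (act ρ (act (flip σ) P)) ≡ P
        back = trans (act-∘ τ ρ (act (flip σ) P)) (trans (act-cong (ρ ∘ₚ τ) σ (act (flip σ) P) λ i → cong (σ ⟨$⟩ˡ_) (inverseʳ τ)) (act-act-flip σ P))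

      same⇒sameFamily : Coarser k same sameFamily
      same⇒sameFamily {A} {B} {C} {D} e f s
        with σ , refl , refl ← orbit A B e | τ , refl , refl ← orbit C D f
        = λ P → mk⇔ (family-along σ τ s P)
            (family-along τ σ (same-sym (act σ A₀) (act σ B₀) (act τ A₀) (act τ B₀) e f s) P)

      -- A family preserved by `G` gives a coarsening of the decomposition. The base edge and its
      -- translate by `σ` have different families, as `act σ P` shows, so the coarsening is not
      -- universal and primitivity makes it equal to `same`.
      same⇔sameFamily : ∀ σ P → family A₀ B₀ P → ¬ family A₀ B₀ (act σ P) →
        ∀ A B C D → Adj k A B → Adj k C D → same A B C D ⇔ sameFamily A B C D
      same⇔sameFamily σ P p ¬σp A B C D e f with noBlocks sameFamily sameFamily-partition sameFamily-invariant same⇒sameFamily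
      ... | inj₁ fine = mk⇔ (Equivalence.from (fine e f)) (Equivalence.to (fine e f))
      ... | inj₂ coarse = contradiction (Equivalence.from (coarse e₀ (e₀· σ) (act σ P)) (natural σ P p)) ¬σp

  -- Equivalence of points under transpositions in the stabiliser.

  infix 4 _~_
  _~_ : Fin n → Fin n → Set
  x ~ y = G (transpose x y)

  -- Transpositions generate `Sym(n)` and `G` is closed under products.
  G-transpositions : (∀ x y → x ~ y) → ∀ σ → G σ
  G-transpositions all σ = G-resp (eval (decompose σ)) σ
    (λ i → injectiveʳ σ (trans (sym (eval-decompose σ _)) (trans (inverseʳ (eval (decompose σ))) (sym (inverseʳ σ)))))
    (products (decompose σ))
    where
    products : ∀ ts → G (eval ts)
    products [] = G-id
    products ((i , j) ∷ ts) = G-∘ (eval ts) (transpose i j) (products ts) (all i j)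

  ~-refl : ∀ x → x ~ x
  ~-refl x = G-fixing (transpose x x) (act-transpose-fixed A₀ refl) (act-transpose-fixed B₀ refl)

  ~-sym : ∀ {x y} → x ~ y → y ~ x
  ~-sym {x} {y} = G-flip (transpose x y)

  -- Conjugating the transposition of `x` and `y` by `σ` gives the transposition of their images.
  ~-act : ∀ σ → G σ → ∀ {x y} → x ~ y → σ ⟨$⟩ʳ x ~ σ ⟨$⟩ʳ y
  ~-act σ g {x} {y} x~y = G-resp (flip σ ∘ₚ (transpose x y ∘ₚ σ)) (transpose (σ ⟨$⟩ʳ x) (σ ⟨$⟩ʳ y))
    -- The points come in the order `y`, `x` because the inverse direction of `transpose x y` is
    -- `PC.transpose y x`.
    (λ i → trans (transpose-conj σ y x (σ ⟨$⟩ˡ i)) (cong (PC.transpose (σ ⟨$⟩ʳ y) (σ ⟨$⟩ʳ x)) (inverseʳ σ)))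
    (G-∘ (transpose x y ∘ₚ σ) (flip σ) (G-∘ σ (transpose x y) g x~y) (G-flip σ g))

  -- When `x` differs from `y` and `z`, conjugating the transposition of `x` and `y` by that of `y`
  -- and `z` gives the transposition of `x` and `z`.
  ~-trans : ∀ {x y z} → x ~ y → y ~ z → x ~ z
  ~-trans {x} {y} {z} x~y y~z with x ≟ y | x ≟ z
  ... | yes refl | _ = y~z
  ... | no _ | yes refl = ~-refl x
  ... | no x≢y | no x≢z = subst₂ _~_ (transpose-other x≢y x≢z) (transpose-fst y z)
    (~-act (transpose y z) y~z x~y)

  fixing : ∀ x y → lookup A₀ x ≡ lookup A₀ y → lookup B₀ x ≡ lookup B₀ y → x ~ y
  fixing x y a b = G-fixing (transpose x y) (act-transpose-fixed A₀ a) (act-transpose-fixed B₀ b)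

  -- `x` and `y` are the only points on which `A₀` and `B₀` disagree, so their transposition
  -- interchanges the two sets.
  colour-exchange : ∀ {x y} → colour A₀ B₀ x ≡ (true , false) → colour A₀ B₀ y ≡ (false , true) → ∀ i →
    lookup A₀ (PC.transpose y x i) ≡ lookup B₀ i × lookup B₀ (PC.transpose y x i) ≡ lookup A₀ i
  colour-exchange {x} {y} cx cy i with i ≟ y
  ... | yes refl = trans (cong proj₁ cx) (sym (cong proj₂ cy)) , trans (cong proj₂ cx) (sym (cong proj₁ cy))
  ... | no i≢y with i ≟ x
  ...   | yes refl = trans (cong proj₁ cy) (sym (cong proj₂ cx)) , trans (cong proj₂ cy) (sym (cong proj₁ cx))
  ...   | no i≢x with lookup A₀ i in ai | lookup B₀ i in bi
  ...     | true  | true  = refl , refl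
  ...     | true  | false = contradiction (fibre-singleton (colour A₀ B₀) (fibre-tf A₀ B₀ e₀) (cong₂ _,_ ai bi) cx) i≢x
  ...     | false | true  = contradiction (fibre-singleton (colour A₀ B₀) (fibre-ft A₀ B₀ e₀) (cong₂ _,_ ai bi) cy) i≢y
  ...     | false | false = refl , refl

  exchange : ∀ {x y} → colour A₀ B₀ x ≡ (true , false) → colour A₀ B₀ y ≡ (false , true) → x ~ y
  exchange {x} {y} cx cy = subst₂ (same A₀ B₀)
    (sym (subset-ext λ i → trans (lookup-act (transpose x y) A₀ i) (proj₁ (colour-exchange cx cy i))))
    (sym (subset-ext λ i → trans (lookup-act (transpose x y) B₀ i) (proj₂ (colour-exchange cx cy i))))
    (same-flip A₀ B₀ e₀)

  kind₀ : Fin n → Part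
  kind₀ = kindAt A₀ B₀

  part₀ : Part → Subset n
  part₀ p = part p A₀ B₀

  -- Points of equal colour have a transposition fixing both ends of the base edge. Only `swap`
  -- contains two colours, and there the transposition reverses the edge.
  same-part⇒~ : ∀ x y → kind₀ x ≡ kind₀ y → x ~ y
  same-part⇒~ x y eq with lookup A₀ x in ax | lookup B₀ x in bx | lookup A₀ y in ay | lookup B₀ y in by
  same-part⇒~ x y () | true  | true  | true  | false
  same-part⇒~ x y () | true  | true  | false | true
  same-part⇒~ x y () | true  | true  | false | false
  same-part⇒~ x y () | true  | false | true  | true
  same-part⇒~ x y () | true  | false | false | false
  same-part⇒~ x y () | false | true  | true  | true
  same-part⇒~ x y () | false | true  | false | false
  same-part⇒~ x y () | false | false | true  | true
  same-part⇒~ x y () | false | false | true  | false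
  same-part⇒~ x y () | false | false | false | true
  ... | true  | false | false | true  = exchange (cong₂ _,_ ax bx) (cong₂ _,_ ay by)
  ... | false | true  | true  | false = ~-sym (exchange (cong₂ _,_ ay by) (cong₂ _,_ ax bx))
  ... | true  | true  | true  | true  = fixing x y (trans ax (sym ay)) (trans bx (sym by))
  ... | true  | false | true  | false = fixing x y (trans ax (sym ay)) (trans bx (sym by))
  ... | false | true  | false | true  = fixing x y (trans ax (sym ay)) (trans bx (sym by))
  ... | false | false | false | false = fixing x y (trans ax (sym ay)) (trans bx (sym by))

  IsClass : Subset n → Set
  IsClass S = ∃[ x ] ∀ y → lookup S y ≡ true ⇔ x ~ y

  -- By `~-act` for `σ` and for its inverse, the class of `x` is carried onto the class of the image
  -- of `x`.
  act-class : ∀ σ → G σ → ∀ S → IsClass S → IsClass (act σ S)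
  act-class σ g S (x , S-is) = σ ⟨$⟩ʳ x , λ y → mk⇔
    (λ σSy → subst (σ ⟨$⟩ʳ x ~_) (inverseʳ σ)
      (~-act σ g (Equivalence.to (S-is (σ ⟨$⟩ˡ y)) (trans (sym (lookup-act σ S y)) σSy))))
    (λ σx~y → trans (lookup-act σ S y) (Equivalence.from (S-is (σ ⟨$⟩ˡ y))
      (subst (_~ (σ ⟨$⟩ˡ y)) (inverseˡ σ) (~-act (flip σ) (G-flip σ g) σx~y))))

  class-member : ∀ S → (c : IsClass S) → lookup S (proj₁ c) ≡ true
  class-member S (x , S-is) = Equivalence.from (S-is x) (~-refl x)

  classes-meet⇒≡ : ∀ S T → IsClass S → IsClass T → ∀ x → lookup S x ≡ true → lookup T x ≡ true → S ≡ T
  classes-meet⇒≡ S T (s , S-is) (t , T-is) x Sx Tx = subset-ext-true λ i → mk⇔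
    (λ Si → Equivalence.from (T-is i) (~-trans t~s (Equivalence.to (S-is i) Si)))
    (λ Ti → Equivalence.from (S-is i) (~-trans (~-sym t~s) (Equivalence.to (T-is i) Ti)))
    where
    t~s : t ~ s
    t~s = ~-trans (Equivalence.to (T-is x) Tx) (~-sym (Equivalence.to (S-is x) Sx))

  -- How the stabiliser moves the parts.

  module _ (rep : Part → Fin n) (kind-rep : ∀ p → kind₀ (rep p) ≡ p) where

    ~-rep : ∀ x → x ~ rep (kind₀ x)
    ~-rep x = same-part⇒~ x (rep (kind₀ x)) (sym (kind-rep (kind₀ x)))

    rep-~ : ∀ p {x} → kind₀ x ≡ p → rep p ~ x
    rep-~ p refl = ~-sym (~-rep _)

    part-class : ∀ p → (∀ q → q ≢ p → ¬ rep p ~ rep q) → IsClass (part₀ p)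
    part-class p apart = rep p , λ y → mk⇔ (λ Sy → rep-~ p (part⁻ A₀ B₀ p Sy)) (back y)
      where
      back : ∀ y → rep p ~ y → lookup (part₀ p) y ≡ true
      back y r with kind₀ y ≟ₚ p
      ... | yes eq = part⁺ A₀ B₀ p eq
      ... | no neq = contradiction (~-trans r (~-rep y)) (apart (kind₀ y) neq)

    complement-class : ∀ p q → q ≢ p → (∀ r → r ≢ p → rep q ~ rep r) → ¬ rep p ~ rep q → IsClass (∁ (part₀ p))
    complement-class p q q≢p joined apart = rep q , λ y → mk⇔ (forth y) (back y)
      where
      forth : ∀ y → lookup (∁ (part₀ p)) y ≡ true → rep q ~ y
      forth y Sy with kind₀ y ≟ₚ p
      ... | yes eq = contradiction (trans (sym Sy) (trans (lookup-map y not (part₀ p)) (cong not (part⁺ A₀ B₀ p eq)))) λ ()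
      ... | no neq = ~-trans (joined (kind₀ y) neq) (~-sym (~-rep y))
      back : ∀ y → rep q ~ y → lookup (∁ (part₀ p)) y ≡ true
      back y r with kind₀ y ≟ₚ p
      ... | yes eq = contradiction (~-trans (rep-~ p eq) (~-sym r)) apart
      ... | no neq = trans (lookup-map y not (part₀ p)) (cong not (part-∉ A₀ B₀ p neq))

    -- Part `p` and its complement are the only classes. The image of part `p` is again a class, and
    -- the location of any one of its points decides which.
    two-classes : ∀ p q → q ≢ p → (∀ r → r ≢ p → rep q ~ rep r) → ¬ rep p ~ rep q →
      ∀ σ → G σ → UpToComplement (part₀ p) (act σ (part₀ p))
    two-classes p q q≢p joined apart σ g = decide (kind₀ (proj₁ σP) ≟ₚ p)
      where
      P = part-class p λ r r≢p p~r → apart (~-trans p~r (~-sym (joined r r≢p)))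
      σP = act-class σ g (part₀ p) P
      decide : Dec (kind₀ (proj₁ σP) ≡ p) → UpToComplement (part₀ p) (act σ (part₀ p))
      decide (yes eq) = inj₁ (classes-meet⇒≡ (act σ (part₀ p)) (part₀ p) σP P _ (class-member (act σ (part₀ p)) σP) (part⁺ A₀ B₀ p eq))
      decide (no neq) = inj₂ (classes-meet⇒≡ (act σ (part₀ p)) (∁ (part₀ p)) σP (complement-class p q q≢p joined apart) _ (class-member (act σ (part₀ p)) σP)
        (trans (lookup-map _ not (part₀ p)) (cong not (part-∉ A₀ B₀ p neq))))

    three-classes : (∀ p q → q ≢ p → ¬ rep p ~ rep q) →
      ∀ σ → G σ → ∀ p → ∃[ q ] act σ (part₀ p) ≡ part₀ q
    three-classes apart σ g p = q , classes-meet⇒≡ (act σ (part₀ p)) (part₀ q) σP (part-class q (apart q)) (proj₁ σP)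
        (class-member (act σ (part₀ p)) σP) (part⁺ A₀ B₀ q refl)
      where
      σP = act-class σ g (part₀ p) (part-class p (apart p))
      q = kind₀ (proj₁ σP)

    -- Each part lies inside one class, so the classes are determined by which of the three
    -- representatives are equivalent.
    G-preserves-parts :
        (∃[ p ] ∀ σ → G σ → UpToComplement (part₀ p) (act σ (part₀ p)))
      ⊎ (∀ σ → G σ → ∀ p → ∃[ q ] act σ (part₀ p) ≡ part₀ q)
    G-preserves-parts
      with excluded-middle (rep meet ~ rep swap) | excluded-middle (rep meet ~ rep rest) | excluded-middle (rep swap ~ rep rest)
    -- All points are equivalent here, so `G` would contain every transposition and hence be all of
    -- `Sym(n)`.
    ... | yes ms | yes mr | _ = contradiction (G-transpositions λ x y → ~-trans (~-sym (to-meet x)) (to-meet y)) G-proper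
      where
      from-meet : ∀ p → rep meet ~ rep p
      from-meet meet = ~-refl (rep meet)
      from-meet swap = ms
      from-meet rest = mr
      to-meet : ∀ x → rep meet ~ x
      to-meet x = ~-trans (from-meet (kind₀ x)) (~-sym (~-rep x))
    -- In the next three cases two parts merge into one class, and the part left alone is preserved
    -- up to complement.
    ... | yes ms | no ¬mr | _ = inj₁ (rest , two-classes rest meet (λ ())
      (λ { meet _ → ~-refl (rep meet) ; swap _ → ms ; rest r → contradiction refl r }) (¬mr ∘ ~-sym))
    ... | no ¬ms | yes mr | _ = inj₁ (swap , two-classes swap meet (λ ())
      (λ { meet _ → ~-refl (rep meet) ; rest _ → mr ; swap r → contradiction refl r }) (¬ms ∘ ~-sym))
    ... | no ¬ms | no ¬mr | yes sr = inj₁ (meet , two-classes meet swap (λ ())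
      (λ { swap _ → ~-refl (rep swap) ; rest _ → sr ; meet r → contradiction refl r }) ¬ms)
    ... | no ¬ms | no ¬mr | no ¬sr = inj₂ (three-classes λ where
      meet meet r → contradiction refl r
      meet swap _ → ¬ms
      meet rest _ → ¬mr
      swap meet _ → ¬ms ∘ ~-sym
      swap swap r → contradiction refl r
      swap rest _ → ¬sr
      rest meet _ → ¬mr ∘ ~-sym
      rest swap _ → ¬sr ∘ ~-sym
      rest rest r → contradiction refl r)

-- Describing `P∩`, `P∪` and `PQQ` by the parts of an edge.

⊆∧∣≡∣⇒≡ : {P Q : Subset n} → P ⊆ Q → ∣ P ∣ ≡ ∣ Q ∣ → P ≡ Q
⊆∧∣≡∣⇒≡ {P = P} {Q} P⊆Q eq = ⊆-antisym P⊆Q λ {x} x∈Q → decidable-stable (x ∈? P)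
  λ x∉P → ℕ.<-irrefl eq (p⊂q⇒∣p∣<∣q∣ (P⊆Q , x , x∈Q , x∉P))

size-∁rest : (A B : Subset n) → Adj k A B → ∣ ∁ (part rest A B) ∣ ≡ suc k
size-∁rest A B e = ℕ.+-cancelˡ-≡ ∣ part rest A B ∣ _ _ (trans (∣P∣+∣∁P∣≡n (part rest A B)) (sym (size-rest A B e)))

-- `Y` is contained in `A ∩ B` and has the same size `k - 1`, so the two coincide.
InP∩⇔ : (Y A B : Subset n) → Adj k A B → InP∩ k Y A B ⇔ Y ≡ part meet A B
InP∩⇔ {k = k} Y A B e = mk⇔
  (λ { (size , Y⊆A , Y⊆B) → trans
     (⊆∧∣≡∣⇒≡ (λ y → x∈p∩q⁺ (Y⊆A y , Y⊆B y)) (ℕ.suc-injective (trans size (sym (proj₂ (proj₂ e))))))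
     (sym (part-meet A B)) })
  (λ eq → subst (λ Z → InP∩ k Z A B) (sym (trans eq (part-meet A B))) (proj₂ (proj₂ e) , p∩q⊆p A B , p∩q⊆q A B))

-- `W` contains `A ∪ B` and both have `k + 1` points; `A ∪ B` is the complement of the part `rest`.
InQ⇔ : (W A B : Subset n) → Adj k A B → InQ k W A B ⇔ W ≡ ∁ (part rest A B)
InQ⇔ {k = k} W A B e = mk⇔
  (λ { (size , A⊆W , B⊆W) → trans (sym (⊆∧∣≡∣⇒≡ ([ A⊆W , B⊆W ]′ ∘ x∈p∪q⁻ A B) (trans size-∪ (sym size)))) (sym (∁-part-rest A B)) })
  (λ eq → subst (λ Z → InQ k Z A B) (sym (trans eq (∁-part-rest A B))) (size-∪ , p⊆p∪q B , q⊆p∪q A B))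
  where
  size-∪ : ∣ A ∪ B ∣ ≡ suc k
  size-∪ = trans (cong ∣_∣ (sym (∁-part-rest A B))) (size-∁rest A B e)

∁-involutive : (P : Subset n) → ∁ (∁ P) ≡ P
∁-involutive P = subset-ext λ i → trans (lookup-map i not (∁ P)) (trans (cong not (lookup-map i not P)) (not-involutive _))

∁-injective : {P Q : Subset n} → ∁ P ≡ ∁ Q → P ≡ Q
∁-injective {P = P} {Q} eq = trans (sym (∁-involutive P)) (trans (cong ∁ eq) (∁-involutive Q))

UpToComplement-sym : {P Q : Subset n} → UpToComplement P Q → UpToComplement Q P
UpToComplement-sym (inj₁ refl) = inj₁ refl
UpToComplement-sym (inj₂ refl) = inj₂ (sym (∁-involutive _))

UpToComplement-trans : {P Q R : Subset n} → UpToComplement P Q → UpToComplement Q R → UpToComplement P R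
UpToComplement-trans (inj₁ refl) r = r
UpToComplement-trans (inj₂ refl) (inj₁ refl) = inj₂ refl
UpToComplement-trans (inj₂ refl) (inj₂ refl) = inj₁ (∁-involutive _)

InQQ⇔ : (W A B : Subset n) → Adj k A B → InQQ k W A B ⇔ UpToComplement (part rest A B) W
InQQ⇔ W A B e = mk⇔
  [ inj₂ ∘ to (InQ⇔ W A B e) , (λ q → inj₁ (∁-injective (to (InQ⇔ (∁ W) A B e) q))) ]′
  [ (λ eq → inj₂ (from (InQ⇔ (∁ W) A B e) (cong ∁ eq))) , inj₁ ∘ from (InQ⇔ W A B e) ]′
  where open Equivalence

-- Describing `P⊖` by the symmetric difference of an edge.

lookup-∪ : ∀ (P Q : Subset n) i → lookup (P ∪ Q) i ≡ lookup P i ∨ lookup Q i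
lookup-∪ P Q i = lookup-zipWith _∨_ i P Q

lookup-∩ : ∀ (P Q : Subset n) i → lookup (P ∩ Q) i ≡ lookup P i ∧ lookup Q i
lookup-∩ P Q i = lookup-zipWith _∧_ i P Q

lookup⇒∉ : ∀ (P : Subset n) {i} → lookup P i ≡ false → i ∉ P
lookup⇒∉ P eq i∈P = contradiction (trans (sym eq) ([]=⇒lookup i∈P)) λ ()

∉⇒lookup : ∀ (P : Subset n) {i} → i ∉ P → lookup P i ≡ false
∉⇒lookup P {i} i∉P = ¬-not λ eq → i∉P (lookup⇒[]= i P eq)

lookup-⁅⁆-self : (i : Fin n) → lookup ⁅ i ⁆ i ≡ true
lookup-⁅⁆-self i = []=⇒lookup (x∈⁅x⁆ i)

lookup-⁅⁆-other : {i j : Fin n} → j ≢ i → lookup ⁅ i ⁆ j ≡ false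
lookup-⁅⁆-other {i = i} j≢i = ∉⇒lookup ⁅ i ⁆ (x≢y⇒x∉⁅y⁆ j≢i)

module _ (A B : Subset n) (e : Adj k A B) where

  edge-shape : ∀ {a b} → colour A B a ≡ (true , false) → colour A B b ≡ (false , true) →
    A ≡ ⁅ a ⁆ ∪ (A ∩ B) × B ≡ ⁅ b ⁆ ∪ (A ∩ B)
  edge-shape {a} {b} ca cb = subset-ext (λ i → trans (onA i) (sym (rhs a i))) , subset-ext (λ i → trans (onB i) (sym (rhs b i)))
    where
    rhs : ∀ c i → lookup (⁅ c ⁆ ∪ (A ∩ B)) i ≡ lookup ⁅ c ⁆ i ∨ (lookup A i ∧ lookup B i)
    rhs c i = trans (lookup-∪ ⁅ c ⁆ (A ∩ B) i) (cong (lookup ⁅ c ⁆ i ∨_) (lookup-∩ A B i))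
    onA : ∀ i → lookup A i ≡ lookup ⁅ a ⁆ i ∨ (lookup A i ∧ lookup B i)
    onA i with i ≟ a
    ... | yes refl rewrite lookup-⁅⁆-self i = cong proj₁ ca
    ... | no i≢a rewrite lookup-⁅⁆-other i≢a with lookup A i in ai | lookup B i in bi
    ...   | true  | true  = refl
    ...   | true  | false = contradiction (fibre-singleton (colour A B) (fibre-tf A B e) (cong₂ _,_ ai bi) ca) i≢a
    ...   | false | _     = refl
    onB : ∀ i → lookup B i ≡ lookup ⁅ b ⁆ i ∨ (lookup A i ∧ lookup B i)
    onB i with i ≟ b
    ... | yes refl rewrite lookup-⁅⁆-self i = cong proj₂ cb
    ... | no i≢b rewrite lookup-⁅⁆-other i≢b with lookup A i in ai | lookup B i in bi
    ...   | true  | true  = refl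
    ...   | false | true  = contradiction (fibre-singleton (colour A B) (fibre-ft A B e) (cong₂ _,_ ai bi) cb) i≢b
    ...   | true  | false = refl
    ...   | false | false = refl

  InM-edge : ∀ {a b} → colour A B a ≡ (true , false) → colour A B b ≡ (false , true) → InM k a b A B
  InM-edge {a} {b} ca cb = A ∩ B , proj₂ (proj₂ e)
    , lookup⇒∉ (A ∩ B) (trans (lookup-∩ A B a) (cong₂ _∧_ (cong proj₁ ca) (cong proj₂ ca)))
    , lookup⇒∉ (A ∩ B) (trans (lookup-∩ A B b) (cong₂ _∧_ (cong proj₁ cb) (cong proj₂ cb)))
    , inj₁ (edge-shape ca cb)

InM-swap : ∀ {a b} (A B : Subset n) → InM k a b A B → InM k b a A B
InM-swap A B (Y , size , a∉Y , b∉Y , inj₁ eq) = Y , size , b∉Y , a∉Y , inj₂ eq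
InM-swap A B (Y , size , a∉Y , b∉Y , inj₂ eq) = Y , size , b∉Y , a∉Y , inj₁ eq

part-swap-⁅⁆∪ : ∀ {a b} (Y : Subset n) → a ≢ b → a ∉ Y → b ∉ Y → part swap (⁅ a ⁆ ∪ Y) (⁅ b ⁆ ∪ Y) ≡ ⁅ a ⁆ ∪ ⁅ b ⁆
part-swap-⁅⁆∪ {a = a} {b} Y a≢b a∉Y b∉Y = subset-ext λ i → trans (lookup-part (⁅ a ⁆ ∪ Y) (⁅ b ⁆ ∪ Y) swap i)
  (trans (cong₂ (λ x y → does (kind x y ≟ₚ swap)) (lookup-∪ ⁅ a ⁆ Y i) (lookup-∪ ⁅ b ⁆ Y i))
    (trans (value i) (sym (lookup-∪ ⁅ a ⁆ ⁅ b ⁆ i))))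
  where
  value : ∀ i → does (kind (lookup ⁅ a ⁆ i ∨ lookup Y i) (lookup ⁅ b ⁆ i ∨ lookup Y i) ≟ₚ swap) ≡ lookup ⁅ a ⁆ i ∨ lookup ⁅ b ⁆ i
  value i with i ≟ a
  ... | yes refl rewrite lookup-⁅⁆-self i | lookup-⁅⁆-other a≢b | ∉⇒lookup Y a∉Y = refl
  ... | no i≢a with i ≟ b
  ...   | yes refl rewrite lookup-⁅⁆-self i | lookup-⁅⁆-other i≢a | ∉⇒lookup Y b∉Y = refl
  ...   | no i≢b rewrite lookup-⁅⁆-other i≢a | lookup-⁅⁆-other i≢b with lookup Y i
  ...     | true  = refl
  ...     | false = refl

InM⇒ : ∀ {a b} (A B : Subset n) → a ≢ b → InM k a b A B → part swap A B ≡ ⁅ a ⁆ ∪ ⁅ b ⁆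
InM⇒ _ _ a≢b (Y , _ , a∉Y , b∉Y , inj₁ (refl , refl)) = part-swap-⁅⁆∪ Y a≢b a∉Y b∉Y
InM⇒ {a = a} {b} _ _ a≢b (Y , _ , a∉Y , b∉Y , inj₂ (refl , refl)) =
  trans (part-comm swap (⁅ b ⁆ ∪ Y) (⁅ a ⁆ ∪ Y)) (part-swap-⁅⁆∪ Y a≢b a∉Y b∉Y)

swap-colour : ∀ (A B : Subset n) {i} → kindAt A B i ≡ swap → colour A B i ≡ (true , false) ⊎ colour A B i ≡ (false , true)
swap-colour A B {i} eq with lookup A i | lookup B i
... | true  | false = inj₁ refl
... | false | true  = inj₂ refl
swap-colour A B () | true  | true
swap-colour A B () | false | false

-- The points `a` and `b` are the single elements of `A ─ B` and `B ─ A`. They also form the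
-- symmetric difference of `C` and `D`, possibly with the roles of the two ends reversed.
P⊖⇔ : (A B C D : Subset n) → Adj k A B → Adj k C D → part swap A B ≡ part swap C D ⇔ P⊖ k A B C D
P⊖⇔ A B C D e f = mk⇔ forth λ { (a , b , a≢b , ab , cd) → trans (InM⇒ A B a≢b ab) (sym (InM⇒ C D a≢b cd)) }
  where
  forth : part swap A B ≡ part swap C D → P⊖ _ A B C D
  forth eq
    with a , ca ← fibre-nonempty (colour A B) (true , false) (fibre-tf A B e)
       | b , cb ← fibre-nonempty (colour A B) (false , true) (fibre-ft A B e)
    = a , b , a≢b , InM-edge A B e ca cb , other (swap-colour C D (in-swap a ca refl)) (swap-colour C D (in-swap b cb refl))
    where
    a≢b : a ≢ b
    a≢b refl = contradiction (trans (sym (cong proj₁ ca)) (cong proj₁ cb)) λ ()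
    in-swap : ∀ i {x y} → colour A B i ≡ (x , y) → kind x y ≡ swap → kindAt C D i ≡ swap
    in-swap i c s = part⁻ C D swap (trans (cong (λ P → lookup P i) (sym eq))
      (part⁺ A B swap (trans (cong₂ kind (cong proj₁ c) (cong proj₂ c)) s)))
    other : _ → _ → InM _ a b C D
    other (inj₁ a′) (inj₂ b′) = InM-edge C D f a′ b′
    other (inj₂ a′) (inj₁ b′) = InM-swap C D (InM-edge C D f b′ a′)
    -- Two distinct points cannot lie on the same side, since `C ─ D` and `D ─ C` are singletons.
    other (inj₁ a′) (inj₁ b′) = contradiction (fibre-singleton (colour C D) (fibre-tf C D f) a′ b′) a≢b
    other (inj₂ a′) (inj₂ b′) = contradiction (fibre-singleton (colour C D) (fibre-ft C D f) a′ b′) a≢b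

-- The three 4-cycles of `J(4,2)`.

_≟ˢ_ : DecidableEquality (Subset n)
_≟ˢ_ = Vec.≡-dec _≟ᵇ_

allSubsets? : {P : Subset n → Set} → (∀ S → Dec (P S)) → Dec (∀ S → P S)
allSubsets? P? = map′ (λ none S → decidable-stable (P? S) λ ¬p → none (S , ¬p)) (λ all → λ { (S , ¬p) → ¬p (all S) })
  (¬? (anySubset? (¬? ∘ P?)))

Adj? : ∀ k (A B : Subset n) → Dec (Adj k A B)
Adj? k A B = (∣ A ∣ ℕ.≟ k) ×-dec (∣ B ∣ ℕ.≟ k) ×-dec (suc ∣ A ∩ B ∣ ℕ.≟ k)

-- An edge of `J(4,2)` avoids exactly one complementary couple of 2-subsets, namely `A ⊖ B` and its
-- complement. This is verified by exhausting the subsets of a 4-set.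
InC4⇔ : (S A B : Subset 4) → ∣ S ∣ ≡ 2 → Adj 2 A B → InC4 S (∁ S) A B ⇔ UpToComplement (part swap A B) S
InC4⇔ S A B s e = mk⇔ (proj₁ (check S s A (proj₁ e) B e)) (proj₂ (check S s A (proj₁ e) B e))
  where
  InC4? : ∀ (S A B : Subset 4) → Dec (InC4 S (∁ S) A B)
  InC4? S A B = ¬? (A ≟ˢ S) ×-dec ¬? (A ≟ˢ ∁ S) ×-dec ¬? (B ≟ˢ S) ×-dec ¬? (B ≟ˢ ∁ S)
  UpTo? : ∀ (P Q : Subset 4) → Dec (UpToComplement P Q)
  UpTo? P Q = (Q ≟ˢ P) ⊎-dec (Q ≟ˢ ∁ P)
  check : ∀ (S : Subset 4) → ∣ S ∣ ≡ 2 → ∀ (A : Subset 4) → ∣ A ∣ ≡ 2 → ∀ B → Adj 2 A B →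
    (InC4 S (∁ S) A B → UpToComplement (part swap A B) S) × (UpToComplement (part swap A B) S → InC4 S (∁ S) A B)
  -- Each size condition is tested before the next quantifier, which cuts the enumeration down
  -- early.
  check = from-yes (allSubsets? λ S → (∣ S ∣ ℕ.≟ 2) →-dec allSubsets? λ A → (∣ A ∣ ℕ.≟ 2) →-dec allSubsets? λ B →
    Adj? 2 A B →-dec ((InC4? S A B →-dec UpTo? (part swap A B) S) ×-dec (UpTo? (part swap A B) S →-dec InC4? S A B)))

disjoint-lookup : (P Q : Subset n) → Empty (P ∩ Q) → ∀ i → lookup P i ∧ lookup Q i ≡ false
disjoint-lookup P Q none i = trans (sym (lookup-∩ P Q i)) (∉⇒lookup (P ∩ Q) λ i∈ → none (i , i∈))

lookup-disjoint : (P Q : Subset n) → (∀ i → lookup P i ∧ lookup Q i ≡ false) → Empty (P ∩ Q)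
lookup-disjoint P Q eq (i , i∈) = lookup⇒∉ (P ∩ Q) (trans (lookup-∩ P Q i) (eq i)) i∈

lookup-⊤ : (i : Fin n) → lookup ⊤ i ≡ true
lookup-⊤ i = []=⇒lookup {i = i} ∈⊤

IsPair2⇒∁ : (S T : Subset n) → IsPair2 S T → T ≡ ∁ S
IsPair2⇒∁ S T (_ , _ , disjoint , cover) = subset-ext λ i → trans
  (value (disjoint-lookup S T disjoint i) (trans (sym (lookup-∪ S T i)) (trans (cong (λ P → lookup P i) cover) (lookup-⊤ i))))
  (sym (lookup-map i not S))
  where
  value : ∀ {s t} → s ∧ t ≡ false → s ∨ t ≡ true → t ≡ not s
  value {true}  {false} _ _ = refl
  value {false} {true}  _ _ = refl

IsPair2-∁ : (S : Subset 4) → ∣ S ∣ ≡ 2 → IsPair2 S (∁ S)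
IsPair2-∁ S s = s , ℕ.+-cancelˡ-≡ 2 _ _ (trans (cong (_+ ∣ ∁ S ∣) (sym s)) (∣P∣+∣∁P∣≡n S))
  , lookup-disjoint S (∁ S) (λ i → trans (cong (lookup S i ∧_) (lookup-map i not S)) (∧-inverseʳ (lookup S i)))
  , p∪∁p≡⊤ S

PC4⇔ : (A B C D : Subset 4) → Adj 2 A B → Adj 2 C D →
  (∃[ S ] UpToComplement (part swap A B) S × UpToComplement (part swap C D) S) ⇔ PC4 A B C D
PC4⇔ A B C D e f = mk⇔ forth back
  where
  open Equivalence
  forth : (∃[ S ] UpToComplement (part swap A B) S × UpToComplement (part swap C D) S) → PC4 A B C D
  forth (S , ab , cd) = S , ∁ S , IsPair2-∁ S s , from (InC4⇔ S A B s e) ab , from (InC4⇔ S C D s f) cd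
    where
    size : UpToComplement (part swap A B) S → ∣ S ∣ ≡ 2
    size (inj₁ refl) = size-swap A B e
    size (inj₂ refl) = proj₁ (proj₂ (IsPair2-∁ (part swap A B) (size-swap A B e)))
    s = size ab
  back : PC4 A B C D → ∃[ S ] UpToComplement (part swap A B) S × UpToComplement (part swap C D) S
  back (S , T , pair@(s , _) , ab , cd) = S , to (InC4⇔ S A B s e) (subst (λ T → InC4 S T A B) T≡∁S ab)
      , to (InC4⇔ S C D s f) (subst (λ T → InC4 S T C D) T≡∁S cd)
    where T≡∁S = IsPair2⇒∁ S T pair

-- Partitions into three pairs and the case of `J(6,3)`.

data ExactlyOne : Bool → Bool → Bool → Set where
  first  : ExactlyOne true  false false
  second : ExactlyOne false true  false
  third  : ExactlyOne false false true

Tripartition : Subset n → Subset n → Subset n → Set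
Tripartition P Q R = ∀ i → ExactlyOne (lookup P i) (lookup Q i) (lookup R i)

exchange₁₂ : ∀ {p q r} → ExactlyOne p q r → ExactlyOne q p r
exchange₁₂ first  = second
exchange₁₂ second = first
exchange₁₂ third  = third

exchange₂₃ : ∀ {p q r} → ExactlyOne p q r → ExactlyOne p r q
exchange₂₃ first  = first
exchange₂₃ second = third
exchange₂₃ third  = second

third-unique : (P Q R R′ : Subset n) → Tripartition P Q R → Tripartition P Q R′ → R ≡ R′
third-unique P Q R R′ t t′ = subset-ext λ i → value (t i) (t′ i)
  where
  value : ∀ {p q r r′} → ExactlyOne p q r → ExactlyOne p q r′ → r ≡ r′
  value first  first  = refl
  value second second = refl
  value third  third  = refl

IsTriple2⇒Tripartition : (P Q R : Subset n) → IsTriple2 P Q R → Tripartition P Q R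
IsTriple2⇒Tripartition P Q R (_ , _ , _ , pq , pr , qr , cover) i = value
  (disjoint-lookup P Q pq i) (disjoint-lookup P R pr i) (disjoint-lookup Q R qr i)
  (trans (sym (trans (lookup-∪ P (Q ∪ R) i) (cong (lookup P i ∨_) (lookup-∪ Q R i))))
    (trans (cong (λ S → lookup S i) cover) (lookup-⊤ i)))
  where
  value : ∀ {p q r} → p ∧ q ≡ false → p ∧ r ≡ false → q ∧ r ≡ false → p ∨ (q ∨ r) ≡ true → ExactlyOne p q r
  value {true}  {false} {false} _ _ _ _ = first
  value {false} {true}  {false} _ _ _ _ = second
  value {false} {false} {true}  _ _ _ _ = third

Tripartition⇒IsTriple2 : (P Q R : Subset n) → ∣ P ∣ ≡ 2 → ∣ Q ∣ ≡ 2 → ∣ R ∣ ≡ 2 → Tripartition P Q R → IsTriple2 P Q R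
Tripartition⇒IsTriple2 P Q R p q r t = p , q , r
  , lookup-disjoint P Q (λ i → 12-disjoint (t i)) , lookup-disjoint P R (λ i → 12-disjoint (exchange₂₃ (t i)))
  , lookup-disjoint Q R (λ i → 12-disjoint (exchange₂₃ (exchange₁₂ (t i))))
  , subset-ext (λ i → trans (trans (lookup-∪ P (Q ∪ R) i) (cong (lookup P i ∨_) (lookup-∪ Q R i))) (trans (covering (t i)) (sym (lookup-⊤ i))))
  where
  12-disjoint : ∀ {p q r} → ExactlyOne p q r → p ∧ q ≡ false
  12-disjoint first  = refl
  12-disjoint second = refl
  12-disjoint third  = refl
  covering : ∀ {p q r} → ExactlyOne p q r → p ∨ (q ∨ r) ≡ true
  covering first  = refl
  covering second = refl
  covering third  = refl

parts-tripartition : (A B : Subset n) → Tripartition (part swap A B) (part meet A B) (part rest A B)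
parts-tripartition A B i rewrite lookup-part A B swap i | lookup-part A B meet i | lookup-part A B rest i with kindAt A B i
... | swap = first
... | meet = second
... | rest = third

IsPart : Subset n → Subset n → Subset n → Set
IsPart A B P = ∃[ p ] P ≡ part p A B

∈π-exchange₁₂ : ∀ {P Q R S : Subset n} → S ∈π (P , Q , R) → S ∈π (Q , P , R)
∈π-exchange₁₂ (inj₁ eq) = inj₂ (inj₁ eq)
∈π-exchange₁₂ (inj₂ (inj₁ eq)) = inj₁ eq
∈π-exchange₁₂ (inj₂ (inj₂ eq)) = inj₂ (inj₂ eq)

∈π-exchange₂₃ : ∀ {P Q R S : Subset n} → S ∈π (P , Q , R) → S ∈π (P , R , Q)
∈π-exchange₂₃ (inj₁ eq) = inj₁ eq
∈π-exchange₂₃ (inj₂ (inj₁ eq)) = inj₂ (inj₂ eq)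
∈π-exchange₂₃ (inj₂ (inj₂ eq)) = inj₂ (inj₁ eq)

∈parts⇔ : (A B S : Subset n) → S ∈π (part swap A B , part meet A B , part rest A B) ⇔ IsPart A B S
∈parts⇔ A B S = mk⇔
  (λ { (inj₁ eq) → swap , eq ; (inj₂ (inj₁ eq)) → meet , eq ; (inj₂ (inj₂ eq)) → rest , eq })
  (λ { (swap , eq) → inj₁ eq ; (meet , eq) → inj₂ (inj₁ eq) ; (rest , eq) → inj₂ (inj₂ eq) })

module _ (A B : Subset n) (swap≢meet : part swap A B ≢ part meet A B) where
  private
    M Y Z : Subset n
    M = part swap A B
    Y = part meet A B
    Z = part rest A B

  -- Two blocks of a tripartition determine the third, so `R` has to be the part `rest`.
  ∈π-ordered : {P Q R : Subset n} → Tripartition P Q R → M ≡ P → Y ≡ Q → ∀ S → S ∈π (P , Q , R) ⇔ IsPart A B S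
  ∈π-ordered {R = R} t refl refl S with refl ← third-unique M Y R Z t (parts-tripartition A B) = ∈parts⇔ A B S

  -- The parts `swap` and `meet` are different blocks; permuting the three blocks puts them first
  -- and second, which reduces to `∈π-ordered`.
  ∈π⇔IsPart : {P Q R : Subset n} → Tripartition P Q R → M ∈π (P , Q , R) → Y ∈π (P , Q , R) →
    ∀ S → S ∈π (P , Q , R) ⇔ IsPart A B S
  ∈π⇔IsPart t (inj₁ m)        (inj₁ y)        S = contradiction (trans m (sym y)) swap≢meet
  ∈π⇔IsPart t (inj₂ (inj₁ m)) (inj₂ (inj₁ y)) S = contradiction (trans m (sym y)) swap≢meet
  ∈π⇔IsPart t (inj₂ (inj₂ m)) (inj₂ (inj₂ y)) S = contradiction (trans m (sym y)) swap≢meet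
  ∈π⇔IsPart t (inj₁ m)        (inj₂ (inj₁ y)) S = ∈π-ordered t m y S
  ∈π⇔IsPart t (inj₁ m)        (inj₂ (inj₂ y)) S =
    ∈π-ordered (λ i → exchange₂₃ (t i)) m y S ⇔-∘ mk⇔ ∈π-exchange₂₃ ∈π-exchange₂₃
  ∈π⇔IsPart t (inj₂ (inj₁ m)) (inj₁ y)        S =
    ∈π-ordered (λ i → exchange₁₂ (t i)) m y S ⇔-∘ mk⇔ ∈π-exchange₁₂ ∈π-exchange₁₂
  ∈π⇔IsPart t (inj₂ (inj₁ m)) (inj₂ (inj₂ y)) S =
    ∈π-ordered (λ i → exchange₂₃ (exchange₁₂ (t i))) m y S ⇔-∘ mk⇔ (∈π-exchange₂₃ ∘ ∈π-exchange₁₂) (∈π-exchange₁₂ ∘ ∈π-exchange₂₃)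
  ∈π⇔IsPart t (inj₂ (inj₂ m)) (inj₁ y)        S =
    ∈π-ordered (λ i → exchange₁₂ (exchange₂₃ (t i))) m y S ⇔-∘ mk⇔ (∈π-exchange₁₂ ∘ ∈π-exchange₂₃) (∈π-exchange₂₃ ∘ ∈π-exchange₁₂)
  ∈π⇔IsPart t (inj₂ (inj₂ m)) (inj₂ (inj₁ y)) S =
    ∈π-ordered (λ i → exchange₁₂ (exchange₂₃ (exchange₁₂ (t i)))) m y S
      ⇔-∘ mk⇔ (∈π-exchange₁₂ ∘ ∈π-exchange₂₃ ∘ ∈π-exchange₁₂) (∈π-exchange₁₂ ∘ ∈π-exchange₂₃ ∘ ∈π-exchange₁₂)

swap≢meet : (A B : Subset n) → Adj k A B → part swap A B ≢ part meet A B
swap≢meet A B e eq with a , ca ← fibre-nonempty (colour A B) (true , false) (fibre-tf A B e) =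
  contradiction (trans (sym (part⁻ A B meet (trans (cong (λ P → lookup P a) (sym eq)) (part⁺ A B swap (kind-a ca))))) (kind-a ca)) λ ()
  where
  kind-a : ∀ {a} → colour A B a ≡ (true , false) → kindAt A B a ≡ swap
  kind-a c = cong₂ kind (cong proj₁ c) (cong proj₂ c)

InPπ⇒ : ∀ π (A B : Subset n) → Adj k A B → IsTriple2 (proj₁ π) (proj₁ (proj₂ π)) (proj₂ (proj₂ π)) → InPπ π A B →
  ∀ S → S ∈π π ⇔ IsPart A B S
InPπ⇒ (P , Q , R) A B e triple (m , y) = ∈π⇔IsPart A B (swap≢meet A B e) (IsTriple2⇒Tripartition P Q R triple)
  (subst (_∈π (P , Q , R)) (sym (part-swap A B)) m) (subst (_∈π (P , Q , R)) (sym (part-meet A B)) y)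

-- All parts of an edge of `J(6,3)` have two points, and they form the only `π` whose divisor
-- contains the edge.
Pπ⇔ : (A B C D : Subset 6) → Adj 3 A B → Adj 3 C D → (∀ S → IsPart A B S ⇔ IsPart C D S) ⇔ Pπ A B C D
Pπ⇔ A B C D e f = mk⇔ forth
  λ { (π , triple , ab , cd) S → InPπ⇒ π C D f triple cd S ⇔-∘ ⇔-sym (InPπ⇒ π A B e triple ab S) }
  where
  π = part swap A B , part meet A B , part rest A B
  inπ : ∀ X Y → (∀ S → IsPart X Y S → S ∈π π) → InPπ π X Y
  inπ X Y sub = subst (_∈π π) (part-swap X Y) (sub _ (swap , refl)) , subst (_∈π π) (part-meet X Y) (sub _ (meet , refl))
  forth : _ → Pπ A B C D
  forth eq = π
    , Tripartition⇒IsTriple2 _ _ _ (size-swap A B e) (ℕ.suc-injective (suc-size-meet A B e))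
        -- Here `4` is `suc k` for `k = 3`, so `rest` has `6 - 4 = 2` points.
        (ℕ.+-cancelʳ-≡ 4 _ _ (size-rest A B e)) (parts-tripartition A B)
    , inπ A B (λ S → Equivalence.from (∈parts⇔ A B S))
    , inπ C D (λ S → Equivalence.from (∈parts⇔ A B S) ∘ Equivalence.from (eq S))

-- The three natural families and the decompositions they give.

exactly : Part → NaturalFamily n
exactly p = record
  { family = λ A B P → P ≡ part p A B
  ; symmetric = λ {A} {B} P eq → trans eq (part-comm p A B)
  ; natural = λ σ {A} {B} P eq → trans (cong (act σ) eq) (act-part σ p A B) }

upToComplement : Part → NaturalFamily n
upToComplement p = record
  { family = λ A B P → UpToComplement (part p A B) P
  ; symmetric = λ {A} {B} P → subst (λ Q → UpToComplement Q P) (part-comm p A B)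
  ; natural = λ σ {A} {B} P → λ where
      (inj₁ eq) → inj₁ (trans (cong (act σ) eq) (act-part σ p A B))
      (inj₂ eq) → inj₂ (trans (cong (act σ) eq) (trans (act-∁ σ (part p A B)) (cong ∁ (act-part σ p A B)))) }

allParts : NaturalFamily n
allParts = record
  { family = IsPart
  ; symmetric = λ { {A} {B} P (p , eq) → p , trans eq (part-comm p A B) }
  ; natural = λ { σ {A} {B} P (p , eq) → p , trans (cong (act σ) eq) (act-part σ p A B) } }

open NaturalFamily using (family; sameFamily)

sameFamily-exactly : ∀ p (A B C D : Subset n) → sameFamily (exactly p) A B C D ⇔ part p A B ≡ part p C D
sameFamily-exactly p A B C D = mk⇔ (λ eq → Equivalence.to (eq (part p A B)) refl)
  (λ eq P → mk⇔ (λ x → trans x eq) (λ x → trans x (sym eq)))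

-- `UpToComplement` is an equivalence relation, so a single common member forces the two families to
-- agree.
sameFamily-upToComplement : ∀ p (A B C D : Subset n) →
  sameFamily (upToComplement p) A B C D ⇔ (∃[ W ] UpToComplement (part p A B) W × UpToComplement (part p C D) W)
sameFamily-upToComplement p A B C D = mk⇔
  (λ eq → part p A B , inj₁ refl , Equivalence.to (eq (part p A B)) (inj₁ refl))
  λ { (W , ab , cd) P → mk⇔
    (λ x → UpToComplement-trans cd (UpToComplement-trans (UpToComplement-sym ab) x))
    (λ x → UpToComplement-trans ab (UpToComplement-trans (UpToComplement-sym cd) x)) }

both⇔ : ∀ {n} {I I′ J J′ : Subset n → Set} → (∀ W → I W ⇔ I′ W) → (∀ W → J W ⇔ J′ W) →
  (∃[ W ] I W × J W) ⇔ (∃[ W ] I′ W × J′ W)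
both⇔ i j = mk⇔ (λ { (W , x , y) → W , to (i W) x , to (j W) y }) (λ { (W , x , y) → W , from (i W) x , from (j W) y })
  where open Equivalence

≡⇔common : {X : Set} {x y : X} → x ≡ y ⇔ (∃[ z ] z ≡ x × z ≡ y)
≡⇔common = mk⇔ (λ eq → _ , refl , eq) (λ { (_ , p , q) → trans (sym p) q })

module _ (A B C D : Subset n) (e : Adj k A B) (f : Adj k C D) where

  exactly-meet⇔ : sameFamily (exactly meet) A B C D ⇔ P∩ k A B C D
  exactly-meet⇔ = both⇔ (λ Y → ⇔-sym (InP∩⇔ Y A B e)) (λ Y → ⇔-sym (InP∩⇔ Y C D f)) ⇔-∘ (≡⇔common
    ⇔-∘ sameFamily-exactly meet A B C D)

  exactly-swap⇔ : sameFamily (exactly swap) A B C D ⇔ P⊖ k A B C D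
  exactly-swap⇔ = P⊖⇔ A B C D e f ⇔-∘ sameFamily-exactly swap A B C D

  exactly-rest⇔ : sameFamily (exactly rest) A B C D ⇔ P∪ k A B C D
  exactly-rest⇔ = both⇔ (λ W → ⇔-sym (InQ⇔ W A B e)) (λ W → ⇔-sym (InQ⇔ W C D f)) ⇔-∘ (≡⇔common
    ⇔-∘ (mk⇔ (cong ∁) ∁-injective ⇔-∘ sameFamily-exactly rest A B C D))

  upToComplement-rest⇔ : sameFamily (upToComplement rest) A B C D ⇔ PQQ k A B C D
  upToComplement-rest⇔ = both⇔ (λ W → ⇔-sym (InQQ⇔ W A B e)) (λ W → ⇔-sym (InQQ⇔ W C D f))
    ⇔-∘ sameFamily-upToComplement rest A B C D

  upToComplement-swap⇔ : n ≡ 4 → k ≡ 2 → sameFamily (upToComplement swap) A B C D ⇔ PC4 A B C D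
  upToComplement-swap⇔ refl refl = PC4⇔ A B C D e f ⇔-∘ sameFamily-upToComplement swap A B C D

  allParts⇔ : n ≡ 6 → k ≡ 3 → sameFamily allParts A B C D ⇔ Pπ A B C D
  allParts⇔ refl refl = Pπ⇔ A B C D e f

-- The image contains `y`, so it is not `P`. It agrees with `P` at the unmoved point `w`, so it is
-- not the complement of `P` either.
transposed-≢ : ∀ {x y w : Fin n} (P : Subset n) → lookup P x ≡ true → lookup P y ≡ false → w ≢ x → w ≢ y →
  ¬ UpToComplement P (act (transpose x y) P)
transposed-≢ {x = x} {y} {w} P Px Py w≢x w≢y (inj₁ eq) = contradiction
  (trans (sym Py) (trans (cong (λ Q → lookup Q y) (sym eq)) (trans (lookup-act (transpose x y) P y)
    (trans (cong (lookup P) (transpose-fst y x)) Px)))) λ ()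
transposed-≢ {x = x} {y} {w} P Px Py w≢x w≢y (inj₂ eq) = not-¬ {x = lookup P w} refl
  (trans (sym (trans (lookup-act (transpose x y) P w) (cong (lookup P) (transpose-other w≢y w≢x))))
    (trans (cong (λ Q → lookup Q w) eq) (lookup-map w not P)))

-- The classification by sizes of the parts.

module Classification {n k : ℕ} (2≤k : 2 ≤ k) (2k≤n : 2 * k ≤ n) (𝒫 : PrimitiveDecomposition n k) where
  open PrimitiveDecomposition 𝒫 using (same)
  open PrimitiveGroup 𝒫

  ∣meet∣ ∣rest∣ : ℕ
  ∣meet∣ = ∣ part₀ meet ∣
  ∣rest∣ = ∣ part₀ rest ∣

  1+∣meet∣ : suc ∣meet∣ ≡ k
  1+∣meet∣ = suc-size-meet A₀ B₀ e₀

  ∣rest∣+1+k : ∣rest∣ + suc k ≡ n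
  ∣rest∣+1+k = size-rest A₀ B₀ e₀

  0<∣meet∣ : 0 < ∣meet∣
  0<∣meet∣ = ℕ.≤-pred (subst (2 ≤_) (sym 1+∣meet∣) 2≤k)

  -- The sizes are `k - 1` and `n - k - 1`, so this is `2 * k ≤ n` rewritten.
  ∣meet∣≤∣rest∣ : ∣meet∣ ≤ ∣rest∣
  ∣meet∣≤∣rest∣ = ℕ.≤-pred (subst (_≤ suc ∣rest∣) (sym 1+∣meet∣) (ℕ.+-cancelʳ-≤ k k (suc ∣rest∣) (begin
    k + k             ≡⟨ cong (k +_) (ℕ.+-identityʳ k) ⟨
    2 * k             ≤⟨ 2k≤n ⟩
    n                 ≡⟨ ∣rest∣+1+k ⟨
    ∣rest∣ + suc k    ≡⟨ ℕ.+-suc ∣rest∣ k ⟩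
    suc ∣rest∣ + k    ∎)))
    where open ℕ.≤-Reasoning

  inhabited : ∀ c m → fibre (colour A₀ B₀) c ≡ m → 0 < m → ∃[ i ] colour A₀ B₀ i ≡ c
  inhabited c (suc m) eq _ = fibre-nonempty (colour A₀ B₀) c eq

  -- No part is empty: `meet` has `k - 1 ≥ 1` points, `swap` has two, and `rest` is at least as
  -- large as `meet`.
  rep′ : ∀ p → ∃[ i ] kind₀ i ≡ p
  rep′ meet with i , eq ← inhabited (true , true) ∣meet∣ (sym (size-part-meet A₀ B₀)) 0<∣meet∣
    = i , cong₂ kind (cong proj₁ eq) (cong proj₂ eq)
  rep′ swap with i , eq ← fibre-nonempty (colour A₀ B₀) (true , false) (fibre-tf A₀ B₀ e₀)
    = i , cong₂ kind (cong proj₁ eq) (cong proj₂ eq)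
  rep′ rest with i , eq ← inhabited (false , false) ∣rest∣ (sym (size-part-rest A₀ B₀)) (ℕ.<-≤-trans 0<∣meet∣ ∣meet∣≤∣rest∣)
    = i , cong₂ kind (cong proj₁ eq) (cong proj₂ eq)

  rep : Part → Fin n
  rep = proj₁ ∘ rep′

  kind-rep : ∀ p → kind₀ (rep p) ≡ p
  kind-rep = proj₂ ∘ rep′

  second-swap : ∃[ b ] kind₀ b ≡ swap × b ≢ rep swap
  second-swap
    with a , ca ← fibre-nonempty (colour A₀ B₀) (true , false) (fibre-tf A₀ B₀ e₀)
    with b , cb ← fibre-nonempty (colour A₀ B₀) (false , true) (fibre-ft A₀ B₀ e₀)
    = b , cong₂ kind (cong proj₁ cb) (cong proj₂ cb) , λ { refl → contradiction (trans (sym (cong proj₁ ca)) (cong proj₁ cb)) λ () }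

  kind≢ : ∀ {x y p q} → kind₀ x ≡ p → kind₀ y ≡ q → p ≢ q → x ≢ y
  kind≢ refl refl p≢q refl = p≢q refl

  -- Transpose a point of part `p` with a point outside it. The second point `b` of `swap` stays in
  -- place and excludes the complement.
  part-moved : ∀ p → ∃[ σ ] ¬ UpToComplement (part₀ p) (act σ (part₀ p))
  part-moved p with b , kb , b≢a ← second-swap = moved p
    where
    moved : ∀ p → ∃[ σ ] ¬ UpToComplement (part₀ p) (act σ (part₀ p))
    outside : ∀ p q → q ≢ p → lookup (part₀ p) (rep q) ≡ false
    outside p q q≢p = part-∉ A₀ B₀ p (λ eq → q≢p (trans (sym (kind-rep q)) eq))
    inside : ∀ p → lookup (part₀ p) (rep p) ≡ true
    inside p = part⁺ A₀ B₀ p (kind-rep p)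
    moved meet = transpose (rep meet) (rep swap) ,
      transposed-≢ (part₀ meet) (inside meet) (outside meet swap λ ()) (kind≢ kb (kind-rep meet) λ ()) b≢a
    moved swap = transpose (rep swap) (rep meet) ,
      transposed-≢ (part₀ swap) (inside swap) (outside swap meet λ ()) b≢a (kind≢ kb (kind-rep meet) λ ())
    moved rest = transpose (rep rest) (rep swap) ,
      transposed-≢ (part₀ rest) (inside rest) (outside rest swap λ ()) (kind≢ kb (kind-rep rest) λ ()) b≢a

  module _ (p : Part) (preserved : ∀ σ → G σ → UpToComplement (part₀ p) (act σ (part₀ p))) where

    -- Permutations preserve size, so no element of `G` can send the part to its complement and the
    -- part is genuinely fixed.
    ≡exactly : ∣ part₀ p ∣ ≢ ∣ ∁ (part₀ p) ∣ → ∀ A B C D → Adj k A B → Adj k C D →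
      same A B C D ⇔ sameFamily (exactly p) A B C D
    ≡exactly unequal = same⇔sameFamily (exactly p) fixed (proj₁ (part-moved p)) (part₀ p) refl (proj₂ (part-moved p) ∘ inj₁)
      where
      fixed : ∀ σ → G σ → ∀ P → P ≡ part₀ p → act σ P ≡ part₀ p
      fixed σ g _ refl with preserved σ g
      ... | inj₁ eq = eq
      ... | inj₂ eq = contradiction (trans (sym (∣act∣ σ (part₀ p))) (cong ∣_∣ eq)) unequal

    ≡upToComplement : ∀ A B C D → Adj k A B → Adj k C D → same A B C D ⇔ sameFamily (upToComplement p) A B C D
    ≡upToComplement = same⇔sameFamily (upToComplement p) permuted (proj₁ (part-moved p)) (part₀ p) (inj₁ refl) (proj₂ (part-moved p))
      where
      permuted : ∀ σ → G σ → ∀ P → UpToComplement (part₀ p) P → UpToComplement (part₀ p) (act σ P)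
      permuted σ g _ (inj₁ refl) = preserved σ g
      permuted σ g _ (inj₂ refl) = UpToComplement-trans (preserved σ g) (inj₂ (act-∁ σ (part₀ p)))

  ≡allParts : (∀ σ → G σ → ∀ p → ∃[ q ] act σ (part₀ p) ≡ part₀ q) →
    ∀ A B C D → Adj k A B → Adj k C D → same A B C D ⇔ sameFamily allParts A B C D
  ≡allParts permuted = same⇔sameFamily allParts (λ { σ g _ (p , refl) → permuted σ g p }) σ₀ (part₀ swap) (swap , refl) moved
    where
    -- The image of `swap` under `σ₀` contains a point of `meet` together with the point `b` of
    -- `swap`, so it is none of the three parts.
    σ₀ = transpose (rep swap) (rep meet)
    moved : ¬ IsPart A₀ B₀ (act σ₀ (part₀ swap))
    moved (q , eq) with b , kb , b≢a ← second-swap = contradiction (trans (trans (sym (kind-rep meet)) (in-q (rep meet) at-meet)) (trans (sym (in-q b at-b)) kb)) λ ()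
      where
      in-q : ∀ i → lookup (act σ₀ (part₀ swap)) i ≡ true → kind₀ i ≡ q
      in-q i l = part⁻ A₀ B₀ q (trans (cong (λ P → lookup P i) (sym eq)) l)
      at-meet : lookup (act σ₀ (part₀ swap)) (rep meet) ≡ true
      at-meet = trans (lookup-act σ₀ (part₀ swap) (rep meet)) (trans (cong (lookup (part₀ swap)) (transpose-fst (rep meet) (rep swap)))
        (part⁺ A₀ B₀ swap (kind-rep swap)))
      at-b : lookup (act σ₀ (part₀ swap)) b ≡ true
      at-b = trans (lookup-act σ₀ (part₀ swap) b) (trans (cong (lookup (part₀ swap)) (transpose-other (kind≢ kb (kind-rep meet) λ ()) b≢a))
        (part⁺ A₀ B₀ swap kb))

  halves : ∀ p → ∣ part₀ p ∣ ≡ ∣ ∁ (part₀ p) ∣ → ∣ part₀ p ∣ + ∣ part₀ p ∣ ≡ n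
  halves p eq = trans (cong (∣ part₀ p ∣ +_) eq) (∣P∣+∣∁P∣≡n (part₀ p))

  -- The complement contains `rest`, which is no smaller than `meet`, and the two points of `swap`
  -- as well.
  meet-not-half : ∣ part₀ meet ∣ ≢ ∣ ∁ (part₀ meet) ∣
  meet-not-half eq = ℕ.<-irrefl (halves meet eq) (begin-strict
    ∣meet∣ + ∣meet∣          <⟨ ℕ.+-mono-≤-< ∣meet∣≤∣rest∣ (ℕ.n<1+n ∣meet∣) ⟩
    ∣rest∣ + suc ∣meet∣      ≡⟨ cong (∣rest∣ +_) 1+∣meet∣ ⟩
    ∣rest∣ + k               ≤⟨ ℕ.+-monoʳ-≤ ∣rest∣ (ℕ.n≤1+n k) ⟩
    ∣rest∣ + suc k           ≡⟨ ∣rest∣+1+k ⟩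
    n                        ∎)
    where open ℕ.≤-Reasoning

  swap-half : ∣ part₀ swap ∣ ≡ ∣ ∁ (part₀ swap) ∣ → n ≡ 4
  swap-half eq = trans (sym (halves swap eq)) (cong₂ _+_ (size-swap A₀ B₀ e₀) (size-swap A₀ B₀ e₀))

  n≡4⇒k≡2 : n ≡ 4 → k ≡ 2
  n≡4⇒k≡2 refl = ℕ.≤-antisym (ℕ.*-cancelˡ-≤ 2 2k≤n) 2≤k

  rest-half : ∣ part₀ rest ∣ ≡ ∣ ∁ (part₀ rest) ∣ → n ≡ 2 * k + 2
  rest-half eq = begin
    n                ≡⟨ halves rest eq ⟨
    ∣rest∣ + ∣rest∣  ≡⟨ cong₂ _+_ size size ⟩
    suc k + suc k    ≡⟨ solve 1 (λ k → (con 1 :+ k) :+ (con 1 :+ k) := con 2 :* k :+ con 2) refl k ⟩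
    2 * k + 2        ∎
    where
    open ≡-Reasoning
    open +-*-Solver
    size = trans eq (size-∁rest A₀ B₀ e₀)

  samePartition : {R : EdgeRel n} → (∀ A B C D → Adj k A B → Adj k C D → same A B C D ⇔ R A B C D) →
    SamePartition k same R
  samePartition eq {A} {B} {C} {D} = eq A B C D

  Classified : Set
  Classified =
      SamePartition k same (P∩ k)
    ⊎ (n ≢ 2 * k + 2 × SamePartition k same (P∪ k))
    ⊎ (¬ (n ≡ 4 × k ≡ 2) × SamePartition k same (P⊖ k))
    ⊎ (n ≡ 2 * k + 2 × SamePartition k same (PQQ k))
    ⊎ (n ≡ 4 × k ≡ 2 × SamePartition k same PC4)
    ⊎ (n ≡ 6 × k ≡ 3 × SamePartition k same Pπ)

  -- `G` can exchange a part with its complement only when the part has `n / 2` points. This never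
  -- happens for `meet`; it needs `n = 4` for `swap` and `n = 2 * k + 2` for `rest`, which separates
  -- the exceptional decompositions from the generic ones.
  from-preserved-part : ∀ p → (∀ σ → G σ → UpToComplement (part₀ p) (act σ (part₀ p))) → Classified
  from-preserved-part meet preserved = inj₁ (samePartition λ A B C D e f →
    exactly-meet⇔ A B C D e f ⇔-∘ ≡exactly meet preserved meet-not-half A B C D e f)
  from-preserved-part swap preserved with n ℕ.≟ 4
  ... | yes n≡4 = inj₂ (inj₂ (inj₂ (inj₂ (inj₁ (n≡4 , n≡4⇒k≡2 n≡4 , samePartition λ A B C D e f →
    upToComplement-swap⇔ A B C D e f n≡4 (n≡4⇒k≡2 n≡4) ⇔-∘ ≡upToComplement swap preserved A B C D e f)))))
  ... | no n≢4 = inj₂ (inj₂ (inj₁ (n≢4 ∘ proj₁ , samePartition λ A B C D e f →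
    exactly-swap⇔ A B C D e f ⇔-∘ ≡exactly swap preserved (n≢4 ∘ swap-half) A B C D e f)))
  from-preserved-part rest preserved with n ℕ.≟ 2 * k + 2
  ... | yes n≡ = inj₂ (inj₂ (inj₂ (inj₁ (n≡ , samePartition λ A B C D e f →
    upToComplement-rest⇔ A B C D e f ⇔-∘ ≡upToComplement rest preserved A B C D e f))))
  ... | no n≢ = inj₂ (inj₁ (n≢ , samePartition λ A B C D e f →
    exactly-rest⇔ A B C D e f ⇔-∘ ≡exactly rest preserved (n≢ ∘ rest-half) A B C D e f))

  module _ (permuted : ∀ σ → G σ → ∀ p → ∃[ q ] act σ (part₀ p) ≡ part₀ q) where

    unique-size⇒preserved : ∀ p → (∀ q → q ≢ p → ∣ part₀ p ∣ ≢ ∣ part₀ q ∣) →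
      ∀ σ → G σ → UpToComplement (part₀ p) (act σ (part₀ p))
    unique-size⇒preserved p unique σ g with q , eq ← permuted σ g p with q ≟ₚ p
    ... | yes refl = inj₁ eq
    ... | no q≢p = contradiction (trans (sym (∣act∣ σ (part₀ p))) (cong ∣_∣ eq)) (unique q q≢p)

    -- If the three sizes are not all equal, one of them differs from the other two, and `G` fixes
    -- the part of that size.
    from-permuted-parts : Classified
    from-permuted-parts with ∣meet∣ ℕ.≟ ∣ part₀ swap ∣ | ∣meet∣ ℕ.≟ ∣rest∣
    ... | no m≢s | no m≢r = from-preserved-part meet (unique-size⇒preserved meet λ where
      meet r → contradiction refl r
      swap _ → m≢s
      rest _ → m≢r)
    ... | no m≢s | yes m≡r = from-preserved-part swap (unique-size⇒preserved swap λ where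
      meet _ → m≢s ∘ sym
      swap r → contradiction refl r
      rest _ s≡r → m≢s (trans m≡r (sym s≡r)))
    ... | yes m≡s | no m≢r = from-preserved-part rest (unique-size⇒preserved rest λ where
      meet _ → m≢r ∘ sym
      swap _ r≡s → m≢r (trans m≡s (sym r≡s))
      rest r → contradiction refl r)
    -- All three sizes equal that of `swap`, which is 2; hence `k = 2 + 1` and `n = 2 + (k + 1)`.
    ... | yes m≡s | yes m≡r = inj₂ (inj₂ (inj₂ (inj₂ (inj₂ (n≡6 , k≡3 , samePartition λ A B C D e f →
      allParts⇔ A B C D e f n≡6 k≡3 ⇔-∘ ≡allParts permuted A B C D e f)))))
      where
      m≡2 : ∣meet∣ ≡ 2
      m≡2 = trans m≡s (size-swap A₀ B₀ e₀)
      k≡3 : k ≡ 3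
      k≡3 = trans (sym 1+∣meet∣) (cong suc m≡2)
      n≡6 : n ≡ 6
      n≡6 = trans (sym ∣rest∣+1+k) (cong₂ (λ r k → r + suc k) (trans (sym m≡r) m≡2) k≡3)

  classified : Classified
  classified with G-preserves-parts rep kind-rep
  ... | inj₁ (p , preserved) = from-preserved-part p preserved
  ... | inj₂ permuted = from-permuted-parts permuted

theorem4p2 : (n k : ℕ) → 2 ≤ k → 2 * k ≤ n → (𝒫 : PrimitiveDecomposition n k) →
    SamePartition k (PrimitiveDecomposition.same 𝒫) (P∩ k)
    ⊎ (n ≢ 2 * k + 2 × SamePartition k (PrimitiveDecomposition.same 𝒫) (P∪ k))
    ⊎ (¬ (n ≡ 4 × k ≡ 2) × SamePartition k (PrimitiveDecomposition.same 𝒫) (P⊖ k))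
    ⊎ (n ≡ 2 * k + 2 × SamePartition k (PrimitiveDecomposition.same 𝒫) (PQQ k))
    ⊎ (n ≡ 4 × k ≡ 2 × SamePartition k (PrimitiveDecomposition.same 𝒫) PC4)
    ⊎ (n ≡ 6 × k ≡ 3 × SamePartition k (PrimitiveDecomposition.same 𝒫) Pπ)
theorem4p2 n k 2≤k 2k≤n 𝒫 = Classification.classified 2≤k 2k≤n 𝒫
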